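{- For $f\in\mathcal L_{4,4}^+$ with normalized coefficients $c_\alpha$ ($\alpha\in\Delta_4^4$; e.g. $c_{1030}$ means $c_{(1,0,3,0)}$), let $$R_4(f)=\frac{c_{1030}\,c_{3010}\,c_{0202}}{c_{2020}\,c_{1012}\,c_{1210}},$$ and let $w_4\in\mathbb R^{\Delta_4^4}$ be its exponent vector (entry $+1$ at the three numerator indices, $-1$ at the three denominator indices, $0$ elsewhere). Then for every $f\in\mathcal L_{4,4}^+$, $R_4(f)\le 64$. Moreover, $$w_4\in\operatorname{BR}(\mathcal L_{4,4}^+)\setminus\operatorname{Cone}\bigl(\mathcal G_4(\Delta_4^4)\bigr).$$
   Context: Notation: $\mathbb N=\mathbb Z_{\ge0}$, $[n]=\{1,\dots,n\}$, $e_i$ is the $i$-th standard basis vector of $\mathbb R^n$; for $\alpha\in\mathbb N^n$, $|\alpha|=\alpha_1+\cdots+\alpha_n$, $\alpha!=\alpha_1!\cdots\alpha_n!$, and $\mathbf x^\alpha=x_1^{\alpha_1}\cdots x_n^{\alpha_n}$; $\Delta_n^d=\{\alpha\in\mathbb N^n:|\alpha|=d\}$. For a finite set $S$, $\varepsilon_\alpha$ ($\alpha\in S$) denotes the standard basis of $\mathbb R^S$. $\operatorname{Cone}(E)$ is the set of finite nonnegative linear combinations of elements of $E$. A nonempty set $S\subseteq\Delta_n^d$ is $M$-convex if, whenever $\alpha,\beta\in S$ and $\alpha_i>\beta_i$, there is $j$ with $\alpha_j<\beta_j$ such that $\alpha-e_i+e_j\in S$ and $\beta-e_j+e_i\in S$.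 Lorentzian polynomials: for $d\ge2$, a polynomial $f=\sum_{\alpha\in\Delta_n^d}c_\alpha\,\mathbf x^\alpha/\alpha!$ with all $c_\alpha\ge0$, not identically zero, is Lorentzian if and only if its support $\{\alpha:c_\alpha\ne0\}$ is $M$-convex and for every $\beta\in\Delta_n^{d-2}$ the symmetric matrix $H_\beta(f)=(c_{\beta+e_i+e_j})_{1\le i,j\le n}$ (the Hessian of $\partial^\beta f$) has at most one positive eigenvalue. The numbers $c_\alpha$ are called the normalized coefficients of $f$. For an $M$-convex $S\subseteq\Delta_n^d$, $\mathcal L_S^+$ is the set of Lorentzian polynomials whose normalized coefficients $c_\alpha$ are positive exactly for $\alpha\in S$; $\mathcal L_{n,d}^+:=\mathcal L_{\Delta_n^d}^+$. For $w\in\mathbb R^S$ and $f\in\mathcal L_S^+$ put $R_w(f)=\prod_{\alpha\in S}c_\alpha^{w_\alpha}$, and $\operatorname{BR}(\mathcal L_S^+)=\{w\in\mathbb R^S:\sup_{f\in\mathcal L_S^+}R_w(f)<\infty\}$. Quadratic local generators: for $\beta\in\Delta_n^{d-2}$ let $S_\beta=\{e_i+e_j:i,j\in[n],\ \beta+e_i+e_j\in S\}\subseteq\Delta_n^2$ (which is $M$-convex whenever nonempty; for $S=\Delta_n^d$ it is $\Delta_n^2$). For $v\in\mathbb R^{S_\beta}$ let $\widetilde v^{\,\beta}=\sum_{\gamma\in S_\beta}v_\gamma\varepsilon_{\beta+\gamma}\in\mathbb R^S$. Then $\mathcal G_n(S)=\bigcup_{\beta\in\Delta_n^{d-2},\,S_\beta\ne\varnothing}\{\widetilde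 v^{\,\beta}:v\in\operatorname{BR}(\mathcal L_{S_\beta}^+)\}$. -}

module Defs where

open import Level using (0ℓ)
open import Algebra.Bundles using (CommutativeRing)
open import Algebra.Core using (Op₁; Op₂)
open import Algebra.Structures using (IsCommutativeRing)
open import Data.Fin.Base using (Fin; zero; suc)
open import Data.Fin.Properties using (any?)
open import Data.List.Base using (List; []; _∷_; _++_; map; filter; foldr)
open import Data.List.Membership.Propositional using () renaming (_∈_ to _∈ₗ_)
open import Data.List.Membership.Propositional.Properties
  using (∈-map⁺; ∈-map⁻; ∈-++⁺ˡ; ∈-++⁺ʳ; ∈-++⁻)
open import Data.List.Relation.Unary.Any using (here)
open import Data.List.Relation.Unary.Unique.Propositional using (Unique; []; _∷_)
import Data.List.Relation.Unary.All as All
import Data.List.Relation.Unary.Unique.Propositional.Properties as Unique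
open import Data.Nat.Base using (ℕ; zero; suc; _∸_)
  renaming (_+_ to _+ℕ_; _<_ to _<ℕ_; _≤_ to _≤ℕ_)
import Data.Nat.Properties as ℕ
open import Data.Product.Base using (Σ; ∃; ∃-syntax; _×_; _,_)
open import Data.Sum.Base using (inj₁; inj₂)
open import Data.Vec.Base using (Vec; []; _∷_; lookup; zipWith; replicate; _[_]≔_; sum)
open import Data.Vec.Functional using (Vector)
import Data.Vec.Properties as Vec
open import Function.Bundles using (_⇔_)
open import Relation.Binary.Core using (Rel)
open import Relation.Binary.Definitions using (DecidableEquality; tri<; tri≈; tri>)
open import Relation.Binary.PropositionalEquality using (_≡_; refl; cong; cong₂; trans; sym)
open import Relation.Binary.Structures using (IsStrictTotalOrder)
open import Relation.Nullary.Decidable using (_×-dec_; does)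
open import Relation.Nullary.Negation using (¬_)
open import Relation.Unary using (Pred; Decidable)
open import Data.Bool.Base using (if_then_else_)
import Algebra.Properties.Semiring.Exp as Exp
import Algebra.Properties.Semiring.Mult as Mult
import Algebra.Properties.Semiring.Sum as Sum
import Relation.Binary.Construct.StrictToNonStrict as StrictToNonStrict

Exponent : ℕ → Set
Exponent n = Vec ℕ n

infix 4 _≟_
_≟_ : ∀ {n} → DecidableEquality (Exponent n)
_≟_ = Vec.≡-dec ℕ._≟_

infixl 6 _⊕_ _⊖_

_⊕_ : ∀ {n} → Exponent n → Exponent n → Exponent n
_⊕_ = zipWith _+ℕ_

-- Truncated; only applied as α ⊖ e i when α has a positive i-th entry.
_⊖_ : ∀ {n} → Exponent n → Exponent n → Exponent n
_⊖_ = zipWith _∸_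

e : ∀ {n} → Fin n → Exponent n
e {n} i = replicate n 0 [ i ]≔ 1

Simplex : ∀ (n d : ℕ) → Pred (Exponent n) 0ℓ
Simplex n d α = sum α ≡ d

incHead : ∀ {n} → Exponent (suc n) → Exponent (suc n)
incHead (k ∷ α) = suc k ∷ α

simplex : ∀ (n d : ℕ) → List (Exponent n)
simplex zero    zero    = [] ∷ []
simplex zero    (suc d) = []
simplex (suc n) zero    = map (0 ∷_) (simplex n 0)
simplex (suc n) (suc d) = map (0 ∷_) (simplex n (suc d)) ++ map incHead (simplex (suc n) d)

simplex-complete : ∀ {n d} α → Simplex n d α → α ∈ₗ simplex n d
simplex-complete {zero}  {zero}  []          refl = here refl
simplex-complete {suc n} {zero}  (zero ∷ α)  eq   = ∈-map⁺ (0 ∷_) (simplex-complete α eq)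
simplex-complete {suc n} {suc d} (zero ∷ α)  eq   =
  ∈-++⁺ˡ (∈-map⁺ (0 ∷_) (simplex-complete α eq))
simplex-complete {suc n} {suc d} (suc k ∷ α) eq   =
  ∈-++⁺ʳ (map (0 ∷_) (simplex n (suc d)))
    (∈-map⁺ incHead (simplex-complete (k ∷ α) (ℕ.suc-injective eq)))

simplex-sound : ∀ {n d} α → α ∈ₗ simplex n d → Simplex n d α
simplex-sound {zero}  {zero}  []  _  = refl
simplex-sound {suc n} {zero}  α   α∈ with ∈-map⁻ (0 ∷_) α∈
... | β , β∈ , refl = simplex-sound β β∈
simplex-sound {suc n} {suc d} α   α∈ with ∈-++⁻ (map (0 ∷_) (simplex n (suc d))) α∈
... | inj₁ α∈ˡ with ∈-map⁻ (0 ∷_) α∈ˡ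
...   | β , β∈ , refl = simplex-sound β β∈
simplex-sound {suc n} {suc d} α   α∈ | inj₂ α∈ʳ with ∈-map⁻ incHead α∈ʳ
...   | k ∷ β , β∈ , refl = cong suc (simplex-sound (k ∷ β) β∈)

simplex-unique : ∀ (n d : ℕ) → Unique (simplex n d)
simplex-unique zero    zero    = All.[] ∷ []
simplex-unique zero    (suc d) = []
simplex-unique (suc n) zero    = Unique.map⁺ Vec.∷-injectiveʳ (simplex-unique n 0)
simplex-unique (suc n) (suc d) =
  Unique.++⁺ (Unique.map⁺ Vec.∷-injectiveʳ (simplex-unique n (suc d)))
             (Unique.map⁺ incHead-injective (simplex-unique (suc n) d))
             disjoint
  where
  incHead-injective : ∀ {α β : Exponent (suc n)} → incHead α ≡ incHead β → α ≡ β
  incHead-injective {k ∷ α} {l ∷ β} refl = refl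

  disjoint : ∀ {α} → ¬ (α ∈ₗ map (0 ∷_) (simplex n (suc d)) ×
                        α ∈ₗ map incHead (simplex (suc n) d))
  disjoint (p , q) with ∈-map⁻ (0 ∷_) p | ∈-map⁻ incHead q
  ... | _ , _ , refl | _ ∷ _ , _ , ()

record Subset (n d : ℕ) : Set₁ where
  field
    _∈S : Pred (Exponent n) 0ℓ
    _∈S? : Decidable _∈S
    ⊆Δ  : ∀ {α} → α ∈S → Simplex n d α

  elements : List (Exponent n)
  elements = filter _∈S? (simplex n d)

infix 4 _∈_
_∈_ : ∀ {n d} → Exponent n → Subset n d → Set
α ∈ S = Subset._∈S S α

Δ : ∀ (n d : ℕ) → Subset n d
Δ n d = record { _∈S = Simplex n d ; _∈S? = λ α → sum α ℕ.≟ d ; ⊆Δ = λ p → p }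

sum-⊕ : ∀ {n} (α β : Exponent n) → sum (α ⊕ β) ≡ sum α +ℕ sum β
sum-⊕ []      []      = refl
sum-⊕ (k ∷ α) (l ∷ β) = trans (cong (k +ℕ l +ℕ_) (sum-⊕ α β)) (interchange k l (sum α) (sum β))
  where
  interchange : ∀ a b c d → (a +ℕ b) +ℕ (c +ℕ d) ≡ (a +ℕ c) +ℕ (b +ℕ d)
  interchange a b c d = trans (ℕ.+-assoc a b (c +ℕ d))
    (trans (cong (a +ℕ_) (trans (sym (ℕ.+-assoc b c d))
      (trans (cong (_+ℕ d) (ℕ.+-comm b c)) (ℕ.+-assoc c b d))))
      (sym (ℕ.+-assoc a c (b +ℕ d))))

sum-e : ∀ {n} (i : Fin n) → sum (e i) ≡ 1
sum-e {suc n} zero    = cong suc (sum-zeros n)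
  where
  sum-zeros : ∀ m → sum (replicate m 0) ≡ 0
  sum-zeros zero    = refl
  sum-zeros (suc m) = sum-zeros m
sum-e {suc n} (suc i) = sum-e i

-- S_β
link : ∀ {n d} → Subset n d → Exponent n → Subset n 2
link S β = record
  { _∈S  = λ γ → ∃[ i ] ∃[ j ] (γ ≡ e i ⊕ e j × β ⊕ e i ⊕ e j ∈ S)
  ; _∈S? = λ γ → any? λ i → any? λ j → (γ ≟ e i ⊕ e j) ×-dec Subset._∈S? S (β ⊕ e i ⊕ e j)
  ; ⊆Δ   = λ { (i , j , refl , _) → trans (sum-⊕ (e i) (e j)) (cong₂ _+ℕ_ (sum-e i) (sum-e j)) }
  }

record MConvex (n d : ℕ) (S : Pred (Exponent n) 0ℓ) : Set where
  field
    ⊆simplex : ∀ {α} → S α → Simplex n d α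
    nonempty : ∃ S
    exchange : ∀ {α β} → S α → S β → ∀ i → lookup β i <ℕ lookup α i →
               ∃[ j ] (lookup α j <ℕ lookup β j × S (α ⊖ e i ⊕ e j) × S (β ⊖ e j ⊕ e i))

-- A complete ordered field; such a structure is unique up to isomorphism, so
-- quantifying over all of them is how a statement about ℝ is expressed.
-- As usual for classical reals, the order is trichotomous, and the inverse and
-- the supremum are total operations constrained only where they make sense.
record CompleteOrderedField : Set₁ where
  infix  8 _⁻¹
  infixl 7 _*_
  infixl 6 _+_
  infix  4 _≈_ _<_
  field
    Carrier            : Set
    _≈_ _<_            : Rel Carrier 0ℓ
    _+_ _*_            : Op₂ Carrier
    -_ _⁻¹             : Op₁ Carrier
    0# 1#              : Carrier
    isCommutativeRing  : IsCommutativeRing _≈_ _+_ _*_ -_ 0# 1#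
    isStrictTotalOrder : IsStrictTotalOrder _≈_ _<_
    0<1                : 0# < 1#
    +-monoˡ-<          : ∀ {x y} z → x < y → x + z < y + z
    *-pos              : ∀ {x y} → 0# < x → 0# < y → 0# < x * y
    ⁻¹-inverseʳ        : ∀ {x} → ¬ (x ≈ 0#) → x * x ⁻¹ ≈ 1#

  open StrictToNonStrict _≈_ _<_ public using (_≤_)

  UpperBound : Pred Carrier 0ℓ → Pred Carrier 0ℓ
  UpperBound P b = ∀ {x} → P x → x ≤ b

  field
    sup       : Pred Carrier 0ℓ → Carrier
    sup-upper : ∀ {P} → ∃ P → ∃ (UpperBound P) → UpperBound P (sup P)
    sup-least : ∀ {P} → ∃ P → ∀ {b} → UpperBound P b → sup P ≤ b

  commutativeRing : CommutativeRing 0ℓ 0ℓ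
  commutativeRing = record { isCommutativeRing = isCommutativeRing }

module Reals (ℝ : CompleteOrderedField) where

  open CompleteOrderedField ℝ public
  open CommutativeRing commutativeRing public using (semiring; _-_)
  open IsStrictTotalOrder isStrictTotalOrder public using (compare)
  open Exp semiring public using (_^_)
  open Mult semiring public using () renaming (_×_ to _×ʳ_)
  open Sum semiring public using () renaming (sum to ∑)

  fromℕ : ℕ → Carrier
  fromℕ k = k ×ʳ 1#

  infixl 7 _/_
  _/_ : Op₂ Carrier
  x / y = x * y ⁻¹

  -- For x ≥ 1: the supremum of the y > 0 such that y ≤ x^((b - a)/q) for some
  -- rational (b - a)/q ≤ w.
  pow≥1 : Carrier → Carrier → Carrier
  pow≥1 x w = sup λ y →
    0# < y × ∃[ a ] ∃[ b ] ∃[ q ]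
      (1 ≤ℕ q × fromℕ b ≤ fromℕ q * w + fromℕ a × (y ^ q) * (x ^ a) ≤ x ^ b)

  -- Real powers x^w of x > 0, with x^w = 1 / (1/x)^w when x < 1.
  pow : Carrier → Carrier → Carrier
  pow x w with compare x 1#
  ... | tri< _ _ _ = pow≥1 (x ⁻¹) w ⁻¹
  ... | tri≈ _ _ _ = pow≥1 x w
  ... | tri> _ _ _ = pow≥1 x w

  Matrix : ℕ → Set
  Matrix n = Fin n → Fin n → Carrier

  NonzeroVector : ∀ {n} → Vector Carrier n → Set
  NonzeroVector v = ∃[ i ] ¬ (v i ≈ 0#)

  Eigenvector : ∀ {n} → Matrix n → Carrier → Vector Carrier n → Set
  Eigenvector H λ′ v = NonzeroVector v × (∀ i → ∑ (λ j → H i j * v j) ≈ λ′ * v i)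

  Eigenvalue : ∀ {n} → Matrix n → Carrier → Set
  Eigenvalue H λ′ = ∃ (Eigenvector H λ′)

  LinearlyDependent : ∀ {n} → Vector Carrier n → Vector Carrier n → Set
  LinearlyDependent u v =
    ∃[ a ] ∃[ b ] (¬ (a ≈ 0# × b ≈ 0#) × (∀ i → a * u i + b * v i ≈ 0#))

  -- Eigenvalues are counted with multiplicity. The matrices considered are
  -- symmetric, so the multiplicity is the dimension of the eigenspace.
  record AtMostOnePositiveEigenvalue {n} (H : Matrix n) : Set where
    field
      unique : ∀ {λ′ μ} → 0# < λ′ → 0# < μ → Eigenvalue H λ′ → Eigenvalue H μ → λ′ ≈ μ
      simple : ∀ {λ′} → 0# < λ′ → ∀ {u v} → Eigenvector H λ′ u → Eigenvector H λ′ v →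
               LinearlyDependent u v

  -- Families indexed by a finite set S of exponents (coefficients, or vectors
  -- of ℝ^S) are functions on all exponents; values outside S are irrelevant,
  -- and equality in ℝ^S is _≈[ S ]_.
  Family : ℕ → Set
  Family n = Exponent n → Carrier

  infix 4 _≈[_]_
  _≈[_]_ : ∀ {n d} → Family n → Subset n d → Family n → Set
  v ≈[ S ] w = ∀ {α} → α ∈ S → v α ≈ w α

  ε : ∀ {n} → Exponent n → Family n
  ε α α′ = if does (α ≟ α′) then 1# else 0#

  Support : ∀ (n d : ℕ) → Family n → Pred (Exponent n) 0ℓ
  Support n d c α = Simplex n d α × ¬ (c α ≈ 0#)

  hessian : ∀ {n} → Family n → Exponent n → Matrix n
  hessian c β i j = c (β ⊕ e i ⊕ e j)

  -- The homogeneous polynomial f = ∑_{α ∈ Δₙᵈ} c_α x^α / α! is represented by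
  -- its normalized coefficients c.
  record Lorentzian (n d : ℕ) (c : Family n) : Set where
    field
      degree≥2        : 2 ≤ℕ d
      nonnegative     : ∀ {α} → Simplex n d α → 0# ≤ c α
      nonzero         : ∃ (Support n d c)
      support-mconvex : MConvex n d (Support n d c)
      hessian-sign    : ∀ {β} → Simplex n (d ∸ 2) β → AtMostOnePositiveEigenvalue (hessian c β)

  -- c ∈ L⁺ S when the polynomial with normalized coefficients c lies in 𝓛_S⁺.
  L⁺ : ∀ {n d} → Subset n d → Pred (Family n) 0ℓ
  L⁺ {n} {d} S c = Lorentzian n d c × (∀ {α} → Simplex n d α → 0# < c α ⇔ α ∈ S)

  -- R_w(f) = ∏_{α ∈ S} c_α^{w_α}
  ratio : ∀ {n d} → Subset n d → Family n → Family n → Carrier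
  ratio S w c = foldr _*_ 1# (map (λ α → pow (c α) (w α)) (Subset.elements S))

  BR : ∀ {n d} → Subset n d → Pred (Family n) 0ℓ
  BR S w = ∃[ M ] (∀ {c} → L⁺ S c → ratio S w c ≤ M)

  Cone : ∀ {n d} → Subset n d → Pred (Family n) 0ℓ → Pred (Family n) 0ℓ
  Cone {n} S E w =
    ∃[ k ] Σ (Vector Carrier k) λ t → Σ (Vector (Family n) k) λ u →
      (∀ i → 0# ≤ t i) × (∀ i → E (u i)) × w ≈[ S ] (λ α → ∑ (λ i → t i * u i α))

  -- ṽ^β = ∑_{γ ∈ S_β} v_γ ε_{β+γ}
  lift : ∀ {n d} → Subset n d → Exponent n → Family n → Family n
  lift S β v α =
    foldr _+_ 0# (map (λ γ → v γ * ε (β ⊕ γ) α) (Subset.elements (link S β)))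

  LocalGenerators : ∀ {n d} → Subset n d → Pred (Family n) 0ℓ
  LocalGenerators {n} {d} S w =
    ∃[ β ] (Simplex n (d ∸ 2) β × ∃ (_∈ link S β) ×
      ∃[ v ] (BR (link S β) v × w ≈[ S ] lift S β v))

  a1030 a3010 a0202 a2020 a1012 a1210 : Exponent 4
  a1030 = 1 ∷ 0 ∷ 3 ∷ 0 ∷ []
  a3010 = 3 ∷ 0 ∷ 1 ∷ 0 ∷ []
  a0202 = 0 ∷ 2 ∷ 0 ∷ 2 ∷ []
  a2020 = 2 ∷ 0 ∷ 2 ∷ 0 ∷ []
  a1012 = 1 ∷ 0 ∷ 1 ∷ 2 ∷ []
  a1210 = 1 ∷ 2 ∷ 1 ∷ 0 ∷ []

  R₄ : Family 4 → Carrier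
  R₄ c = (c a1030 * c a3010 * c a0202) / (c a2020 * c a1012 * c a1210)

  w₄ : Family 4
  w₄ α = ε a1030 α + ε a3010 α + ε a0202 α - ε a2020 α - ε a1012 α - ε a1210 α

{-# OPTIONS --safe #-}

-- The bound: a matrix with at most one positive eigenvalue satisfies the reverse Cauchy–Schwarz inequality, which for
-- positive entries gives c_ii c_jk ≤ 2 c_ij c_ik and c_ij c_kl ≤ 4 max(c_ik c_jl, c_il c_jk). Four inequalities of the
-- first kind and one of the second, from the Hessians at several β, multiply to R₄ ≤ 2⁴ · 4.
--
-- The cone: if t^a is Lorentzian with full support for all t ≥ 1, then every bounded ratio vector v satisfies
-- ⟨v, a⟩ ≤ 0. Hence a functional ℓ on ℝ^{Δ₄⁴} whose restriction to each link is a sum of such exponents a (with a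
-- different decomposition for each link) is nonpositive on all local generators. One such ℓ has ⟨ℓ, w₄⟩ = 4.

module Submission where

open import Defs
open import Algebra.Bundles using (CommutativeRing)
import Algebra.Properties.AbelianGroup as AbelianGroupProperties
open import Algebra.Properties.CommutativeSemigroup using (interchange)
import Algebra.Properties.CommutativeSemiring.Exp as CommutativeExp
import Algebra.Properties.Ring as RingProperties
import Algebra.Properties.Semiring.Exp as Exp
import Algebra.Properties.Semiring.Mult as Mult
import Algebra.Properties.Semiring.Sum as Sum
import Algebra.Solver.Ring as RingSolver
open import Algebra.Solver.Ring.AlmostCommutativeRing
  using (fromCommutativeRing; _-Raw-AlmostCommutative⟶_)
open import Data.Bool.Base using (Bool; true; false; if_then_else_; _∧_)
open import Data.Empty using (⊥-elim)
open import Data.Fin.Base using (Fin; zero; suc)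
open import Data.Fin.Properties using (any?)
open import Data.Integer.Base as ℤ using (ℤ; +_; -[1+_])
import Data.Integer.Properties as ℤ
open import Data.List.Base as List using (List; []; _∷_; foldr)
open import Data.List.Membership.Propositional using () renaming (_∈_ to _∈ₗ_)
import Data.List.Properties as List
open import Data.List.Relation.Unary.All as All using (All; []; _∷_)
open import Data.List.Relation.Unary.Any using (here; there)
open import Data.List.Relation.Unary.Unique.Propositional using (Unique; _∷_)
open import Data.Maybe.Base using (map)
open import Data.Nat.Base as ℕ using (ℕ; zero; suc)
import Data.Nat.Properties as ℕ
open import Data.Product.Base using (∃; ∃-syntax; _×_; _,_; proj₁; proj₂)
import Data.Sign.Base as Sign
open import Data.Sum.Base using (_⊎_; inj₁; inj₂)
open import Data.Vec.Base as Vec using (Vec; []; _∷_; lookup; replicate; sum)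
open import Data.Vec.Functional using (Vector; tail) renaming (_∷_ to infixr 5 _∷ᶠ_)
import Data.Vec.Properties as Vec
open import Function.Bundles using (Equivalence; mk⇔)
open import Level using (0ℓ)
open import Relation.Binary.Bundles using (StrictTotalOrder)
open import Relation.Binary.Definitions using (Tri; tri<; tri≈; tri>)
import Relation.Binary.Properties.StrictTotalOrder as STO
open import Relation.Binary.PropositionalEquality as ≡ using (_≡_)
import Relation.Binary.Reasoning.Setoid as SetoidReasoning
import Relation.Binary.Reasoning.StrictPartialOrder as SPOReasoning
open import Relation.Nullary.Decidable using (yes; no; does; True; toWitness; from-yes)
open import Relation.Nullary.Decidable.Core using (dec⇒maybe)
open import Relation.Nullary.Negation using (¬_)
open import Relation.Unary using (Pred)

-- Four of the five inequalities are local bounded ratios. The one at β = 0101 is not: it bounds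
-- c₁₁₁₁ c₀₂₀₂ by a maximum of two products, and which of them is larger depends on f. Each
-- alternative is completed by its own chain, so `w₄` is bounded although no combination of local
-- ratios shows it. The separating functional lives on this gap. At β = 0101 it is a sum of two
-- Lorentzian exponents, each compatible with a different alternative. Lorentzian exponents are not
-- closed under addition: the sum gives 24 on c₁₁₁₁ c₀₂₀₂ and 20 on both alternatives, against the
-- maximum inequality. The condition ⟨v, a⟩ ≤ 0 is additive in a, so bounded ratios of the link
-- still pair nonpositively with the sum. Two obstacles shape the rest. The signature condition
-- speaks only about eigenvectors that happen to exist, so reverse Cauchy-Schwarz first needs one,
-- which is built from a supremum. And completeness yields natural bounds and integer parts only up
-- to double negation; this suffices because the goals are non-strict inequalities, which trichotomy
-- makes stable.

module _ (ℝ : CompleteOrderedField) where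

  open Reals ℝ
  module R = CommutativeRing commutativeRing
  module RP = RingProperties R.ring
  module RG = AbelianGroupProperties R.+-abelianGroup
  open Mult semiring using (×-homo-+; ×1-homo-*)
  open Sum semiring using (*-distribˡ-sum; ∑-distrib-+; ∑-comm; sum-cong-≋)
  open Exp semiring using (^-homo-*; ^-assocʳ; ^-congˡ)
  open CommutativeExp R.commutativeSemiring using (^-distrib-*)
  module ≈-Reasoning = SetoidReasoning R.setoid

  strictTotalOrder : StrictTotalOrder 0ℓ 0ℓ 0ℓ
  strictTotalOrder = record { isStrictTotalOrder = isStrictTotalOrder }

  module < = StrictTotalOrder strictTotalOrder
  module ≤ = STO strictTotalOrder
  module ≤-Reasoning = SPOReasoning <.strictPartialOrder

  -- Integers in the field, as coefficients for the ring solver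

  fromℤ : ℤ → Carrier
  fromℤ (+ n)    = fromℕ n
  fromℤ -[1+ n ] = - fromℕ (suc n)

  module _ where
    open ≈-Reasoning

    cancel-1 : ∀ x y → x - y ≈ (1# + x) - (1# + y)
    cancel-1 x y = begin
      x - y                     ≈⟨ R.+-identityˡ _ ⟨
      0# + (x - y)              ≈⟨ R.+-congʳ (R.-‿inverseʳ 1#) ⟨
      (1# - 1#) + (x - y)       ≈⟨ R.+-assoc _ _ _ ⟩
      1# + (- 1# + (x - y))     ≈⟨ R.+-congˡ (R.+-assoc _ _ _) ⟨
      1# + (- 1# + x - y)       ≈⟨ R.+-congˡ (R.+-congʳ (R.+-comm _ _)) ⟩
      1# + (x - 1# - y)         ≈⟨ R.+-congˡ (R.+-assoc _ _ _) ⟩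
      1# + (x + (- 1# - y))     ≈⟨ R.+-assoc _ _ _ ⟨
      1# + x + (- 1# - y)       ≈⟨ R.+-congˡ (RG.⁻¹-∙-comm 1# y) ⟩
      (1# + x) - (1# + y)       ∎

    fromℤ-⊖ : ∀ m n → fromℤ (m ℤ.⊖ n) ≈ fromℕ m - fromℕ n
    fromℤ-⊖ m       zero    = R.sym (R.trans (R.+-congˡ RG.ε⁻¹≈ε) (R.+-identityʳ _))
    fromℤ-⊖ zero    (suc n) = R.sym (R.+-identityˡ _)
    fromℤ-⊖ (suc m) (suc n) = begin
      fromℤ (suc m ℤ.⊖ suc n)         ≡⟨ ≡.cong fromℤ (ℤ.[1+m]⊖[1+n]≡m⊖n m n) ⟩
      fromℤ (m ℤ.⊖ n)                 ≈⟨ fromℤ-⊖ m n ⟩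
      fromℕ m - fromℕ n               ≈⟨ cancel-1 _ _ ⟩
      fromℕ (suc m) - fromℕ (suc n)   ∎

    fromℤ-neg : ∀ i → fromℤ (ℤ.- i) ≈ - fromℤ i
    fromℤ-neg (+ zero)  = R.sym RG.ε⁻¹≈ε
    fromℤ-neg (+ suc n) = R.refl
    fromℤ-neg -[1+ n ]  = R.sym (RG.⁻¹-involutive _)

    fromℤ-+ : ∀ i j → fromℤ (i ℤ.+ j) ≈ fromℤ i + fromℤ j
    fromℤ-+ (+ m)    (+ n)    = ×-homo-+ 1# m n
    fromℤ-+ (+ m)    -[1+ n ] = fromℤ-⊖ m (suc n)
    fromℤ-+ -[1+ m ] (+ n)    = R.trans (fromℤ-⊖ n (suc m)) (R.+-comm _ _)
    fromℤ-+ -[1+ m ] -[1+ n ] = begin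
      - fromℕ (suc (suc (m ℕ.+ n)))       ≡⟨ ≡.cong (λ k → - fromℕ (suc k)) (ℕ.+-suc m n) ⟨
      - fromℕ (suc m ℕ.+ suc n)           ≈⟨ R.-‿cong (×-homo-+ 1# (suc m) (suc n)) ⟩
      - (fromℕ (suc m) + fromℕ (suc n))   ≈⟨ RG.⁻¹-∙-comm _ _ ⟨
      - fromℕ (suc m) - fromℕ (suc n)     ∎

    fromℤ-* : ∀ i j → fromℤ (i ℤ.* j) ≈ fromℤ i * fromℤ j
    fromℤ-* (+ m)    (+ n)    = begin
      fromℤ (Sign.+ ℤ.◃ m ℕ.* n)       ≡⟨ ≡.cong fromℤ (ℤ.+◃n≡+n (m ℕ.* n)) ⟩
      fromℕ (m ℕ.* n)             ≈⟨ ×1-homo-* m n ⟩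
      fromℕ m * fromℕ n           ∎
    fromℤ-* (+ m)    -[1+ n ] = begin
      fromℤ (Sign.- ℤ.◃ m ℕ.* suc n)   ≡⟨ ≡.cong fromℤ (ℤ.-◃n≡-n (m ℕ.* suc n)) ⟩
      fromℤ (ℤ.- + (m ℕ.* suc n)) ≈⟨ fromℤ-neg (+ (m ℕ.* suc n)) ⟩
      - fromℕ (m ℕ.* suc n)       ≈⟨ R.-‿cong (×1-homo-* m (suc n)) ⟩
      - (fromℕ m * fromℕ (suc n)) ≈⟨ RP.-‿distribʳ-* _ _ ⟩
      fromℕ m * - fromℕ (suc n)   ∎
    fromℤ-* -[1+ m ] (+ n)    = begin
      fromℤ (Sign.- ℤ.◃ suc m ℕ.* n)   ≡⟨ ≡.cong fromℤ (ℤ.-◃n≡-n (suc m ℕ.* n)) ⟩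
      fromℤ (ℤ.- + (suc m ℕ.* n)) ≈⟨ fromℤ-neg (+ (suc m ℕ.* n)) ⟩
      - fromℕ (suc m ℕ.* n)       ≈⟨ R.-‿cong (×1-homo-* (suc m) n) ⟩
      - (fromℕ (suc m) * fromℕ n) ≈⟨ RP.-‿distribˡ-* _ _ ⟩
      - fromℕ (suc m) * fromℕ n   ∎
    fromℤ-* -[1+ m ] -[1+ n ] = begin
      fromℕ (suc m ℕ.* suc n)              ≈⟨ ×1-homo-* (suc m) (suc n) ⟩
      fromℕ (suc m) * fromℕ (suc n)        ≈⟨ RG.⁻¹-involutive _ ⟨
      - - (fromℕ (suc m) * fromℕ (suc n))  ≈⟨ R.-‿cong (RP.-‿distribˡ-* _ _) ⟩
      - (- fromℕ (suc m) * fromℕ (suc n))  ≈⟨ RP.-‿distribʳ-* _ _ ⟩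
      - fromℕ (suc m) * - fromℕ (suc n)    ∎

  -- The solver normalises over ℤ, where equality of coefficients is decided by evaluation. The
  -- numeral `con (+ 1)` denotes `1# + 0#`, so identities about `1#` itself pass it as one more
  -- variable.
  ℤ-coefficients : ℤ.+-*-rawRing -Raw-AlmostCommutative⟶ fromCommutativeRing commutativeRing
  ℤ-coefficients = record
    { ⟦_⟧    = fromℤ
    ; +-homo = fromℤ-+
    ; *-homo = fromℤ-*
    ; -‿homo = fromℤ-neg
    ; 0-homo = R.refl
    ; 1-homo = R.+-identityʳ 1#
    }

  open RingSolver ℤ.+-*-rawRing (fromCommutativeRing commutativeRing) ℤ-coefficients
    (λ i j → map (λ eq → R.reflexive (≡.cong fromℤ eq)) (dec⇒maybe (i ℤ.≟ j)))
    using (solve; _:=_; _:+_; _:*_; _:-_; :-_; con; _:^_)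

  -- Order

  0≤-⇒≤ : ∀ {x y} → 0# ≤ y - x → x ≤ y
  0≤-⇒≤ {x} {y} (inj₁ p) = inj₁ (<.<-resp-≈ .proj₁ eq (<.<-resp-≈ .proj₂ (R.+-identityˡ x) (+-monoˡ-< x p)))
    where
    eq : (y - x) + x ≈ y
    eq = solve 2 (λ x y → (y :- x) :+ x := y) R.refl x y
  0≤-⇒≤ {x} {y} (inj₂ p) = inj₂ (R.trans (R.sym (R.+-identityˡ x))
    (R.trans (R.+-congʳ p) (solve 2 (λ x y → (y :- x) :+ x := y) R.refl x y)))

  0<-⇒< : ∀ {x y} → 0# < y - x → x < y
  0<-⇒< {x} {y} p = <.<-resp-≈ .proj₁ (solve 2 (λ x y → (y :- x) :+ x := y) R.refl x y)
    (<.<-resp-≈ .proj₂ (R.+-identityˡ x) (+-monoˡ-< x p))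

  <⇒0<- : ∀ {x y} → x < y → 0# < y - x
  <⇒0<- {x} {y} p = <.<-resp-≈ .proj₂ (R.-‿inverseʳ x) (+-monoˡ-< (- x) p)

  ≤⇒0≤- : ∀ {x y} → x ≤ y → 0# ≤ y - x
  ≤⇒0≤- (inj₁ p) = inj₁ (<⇒0<- p)
  ≤⇒0≤- {x} (inj₂ p) = inj₂ (R.trans (R.sym (R.-‿inverseʳ x)) (R.+-congʳ p))

  <-≤-trans : ∀ {x y z} → x < y → y ≤ z → x < z
  <-≤-trans p (inj₁ q) = <.trans p q
  <-≤-trans p (inj₂ q) = <.<-resp-≈ .proj₁ q p

  ≤-<-trans : ∀ {x y z} → x ≤ y → y < z → x < z
  ≤-<-trans (inj₁ p) q = <.trans p q
  ≤-<-trans (inj₂ p) q = <.<-resp-≈ .proj₂ (R.sym p) q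

  -- This is how witnesses known only up to double negation are put to use: an inequality `≤` may be
  -- proved by refuting its strict reverse.
  ≮⇒≥ : ∀ {x y} → ¬ (x < y) → y ≤ x
  ≮⇒≥ {x} {y} x≮y with compare x y
  ... | tri< p _ _ = ⊥-elim (x≮y p)
  ... | tri≈ _ p _ = inj₂ (R.sym p)
  ... | tri> _ _ p = inj₁ p

  ≤⇒≯ : ∀ {x y} → x ≤ y → ¬ (y < x)
  ≤⇒≯ p q = <.irrefl R.refl (≤-<-trans p q)

  +-monoʳ-≤ : ∀ z {x y} → x ≤ y → z + x ≤ z + y
  +-monoʳ-≤ z (inj₁ p) = inj₁
      (<.<-resp-≈ .proj₁ (R.+-comm _ _) (<.<-resp-≈ .proj₂ (R.+-comm _ _) (+-monoˡ-< z p)))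
  +-monoʳ-≤ z (inj₂ p) = inj₂ (R.+-congˡ p)

  +-monoˡ-≤ : ∀ z {x y} → x ≤ y → x + z ≤ y + z
  +-monoˡ-≤ z (inj₁ p) = inj₁ (+-monoˡ-< z p)
  +-monoˡ-≤ z (inj₂ p) = inj₂ (R.+-congʳ p)

  +-mono-≤ : ∀ {x y u v} → x ≤ y → u ≤ v → x + u ≤ y + v
  +-mono-≤ p q = ≤.trans (+-monoˡ-≤ _ p) (+-monoʳ-≤ _ q)

  +-mono-<-≤ : ∀ {x y u v} → x < y → u ≤ v → x + u < y + v
  +-mono-<-≤ p q = <-≤-trans (+-monoˡ-< _ p) (+-monoʳ-≤ _ q)

  +-nonneg : ∀ {x y} → 0# ≤ x → 0# ≤ y → 0# ≤ x + y
  +-nonneg p q = ≤.trans (inj₂ (R.sym (R.+-identityˡ 0#))) (+-mono-≤ p q)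

  +-pos-nonneg : ∀ {x y} → 0# < x → 0# ≤ y → 0# < x + y
  +-pos-nonneg p q = ≤-<-trans (inj₂ (R.sym (R.+-identityˡ 0#))) (+-mono-<-≤ p q)

  *-nonneg : ∀ {x y} → 0# ≤ x → 0# ≤ y → 0# ≤ x * y
  *-nonneg (inj₁ p) (inj₁ q) = inj₁ (*-pos p q)
  *-nonneg {x} {y} (inj₂ p) _ = inj₂ (R.trans (R.sym (R.zeroˡ y)) (R.*-congʳ p))
  *-nonneg {x} {y} (inj₁ _) (inj₂ q) = inj₂ (R.trans (R.sym (R.zeroʳ x)) (R.*-congˡ q))

  *-monoʳ-≤ : ∀ {z} → 0# ≤ z → ∀ {x y} → x ≤ y → z * x ≤ z * y
  *-monoʳ-≤ 0≤z p = 0≤-⇒≤ (≤.trans (*-nonneg 0≤z (≤⇒0≤- p)) (inj₂ (RP.x[y-z]≈xy-xz _ _ _)))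

  *-monoˡ-≤ : ∀ {z} → 0# ≤ z → ∀ {x y} → x ≤ y → x * z ≤ y * z
  *-monoˡ-≤ 0≤z p = 0≤-⇒≤ (≤.trans (*-nonneg (≤⇒0≤- p) 0≤z) (inj₂ (RP.[y-z]x≈yx-zx _ _ _)))

  *-monoʳ-< : ∀ {z} → 0# < z → ∀ {x y} → x < y → z * x < z * y
  *-monoʳ-< 0<z p = 0<-⇒< (<-≤-trans (*-pos 0<z (<⇒0<- p)) (inj₂ (RP.x[y-z]≈xy-xz _ _ _)))

  *-mono-≤ : ∀ {x y u v} → 0# ≤ x → 0# ≤ v → x ≤ y → u ≤ v → x * u ≤ y * v
  *-mono-≤ 0≤x 0≤v p q = ≤.trans (*-monoʳ-≤ 0≤x q) (*-monoˡ-≤ 0≤v p)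

  *-cancelˡ-≤ : ∀ {z} → 0# < z → ∀ {x y} → z * x ≤ z * y → x ≤ y
  *-cancelˡ-≤ 0<z p = ≮⇒≥ λ q → ≤⇒≯ p (*-monoʳ-< 0<z q)

  *-cancelˡ-pos : ∀ {x y} → 0# < x → 0# < x * y → 0# < y
  *-cancelˡ-pos {x} {y} 0<x p with compare 0# y
  ... | tri< q _ _ = q
  ... | tri≈ _ q _ = ⊥-elim (<.irrefl (R.trans (R.sym (R.zeroʳ x)) (R.*-congˡ q)) p)
  ... | tri> _ _ q = ⊥-elim (<.asym p (<-≤-trans (*-monoʳ-< 0<x q) (inj₂ (R.zeroʳ x))))

  neg-pos : ∀ {x} → x < 0# → 0# < - x
  neg-pos p = <-≤-trans (<⇒0<- p) (inj₂ (R.+-identityˡ _))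

  sq-pos : ∀ {x} → ¬ (x ≈ 0#) → 0# < x * x
  sq-pos {x} x≉0 with compare x 0#
  ... | tri< p _ _ = <-≤-trans (*-pos (neg-pos p) (neg-pos p)) (inj₂ (solve 1 (λ x → :- x :* :- x := x :* x) R.refl x))
  ... | tri≈ _ p _ = ⊥-elim (x≉0 p)
  ... | tri> _ _ p = *-pos p p

  sq-nonneg : ∀ x → 0# ≤ x * x
  sq-nonneg x with compare x 0#
  ... | tri< _ p _ = inj₁ (sq-pos p)
  ... | tri≈ _ p _ = inj₂ (R.sym (R.trans (R.*-congʳ p) (R.zeroˡ x)))
  ... | tri> _ p _ = inj₁ (sq-pos p)

  pos⇒≉0 : ∀ {x} → 0# < x → ¬ (x ≈ 0#)
  pos⇒≉0 p q = <.irrefl (R.sym q) p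

  *-integral : ∀ {x y} → ¬ (x ≈ 0#) → x * y ≈ 0# → y ≈ 0#
  *-integral {x} {y} x≉0 p = begin
    y                  ≈⟨ R.*-identityˡ y ⟨
    1# * y             ≈⟨ R.*-congʳ (⁻¹-inverseʳ x≉0) ⟨
    x * x ⁻¹ * y       ≈⟨ solve 3 (λ x y z → x :* z :* y := z :* (x :* y)) R.refl x y (x ⁻¹) ⟩
    x ⁻¹ * (x * y)     ≈⟨ R.*-congˡ p ⟩
    x ⁻¹ * 0#          ≈⟨ R.zeroʳ _ ⟩
    0#                 ∎
    where open ≈-Reasoning

  *-cancelˡ-≈ : ∀ {z x y} → ¬ (z ≈ 0#) → z * x ≈ z * y → x ≈ y
  *-cancelˡ-≈ z≉0 p = RG.x∙y⁻¹≈ε⇒x≈y _ _ (*-integral z≉0 (R.trans (RP.x[y-z]≈xy-xz _ _ _) (RG.x≈y⇒x∙y⁻¹≈ε p)))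

  ⁻¹-unique : ∀ {x y} → 0# < x → x * y ≈ 1# → y ≈ x ⁻¹
  ⁻¹-unique 0<x p = *-cancelˡ-≈ (pos⇒≉0 0<x) (R.trans p (R.sym (⁻¹-inverseʳ (pos⇒≉0 0<x))))

  ⁻¹-pos : ∀ {x} → 0# < x → 0# < x ⁻¹
  ⁻¹-pos 0<x = *-cancelˡ-pos 0<x (<-≤-trans 0<1 (inj₂ (R.sym (⁻¹-inverseʳ (pos⇒≉0 0<x)))))

  0≤1 : 0# ≤ 1#
  0≤1 = inj₁ 0<1

  fromℕ-nonneg : ∀ n → 0# ≤ fromℕ n
  fromℕ-nonneg zero    = ≤.refl
  fromℕ-nonneg (suc n) = +-nonneg 0≤1 (fromℕ-nonneg n)

  fromℕ-pos : ∀ {n} → 1 ℕ.≤ n → 0# < fromℕ n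
  fromℕ-pos (ℕ.s≤s {n = n} _) = +-pos-nonneg 0<1 (fromℕ-nonneg n)

  fromℕ-mono-≤ : ∀ {m n} → m ℕ.≤ n → fromℕ m ≤ fromℕ n
  fromℕ-mono-≤ {n = n} ℕ.z≤n = fromℕ-nonneg n
  fromℕ-mono-≤ (ℕ.s≤s p) = +-monoʳ-≤ 1# (fromℕ-mono-≤ p)

  fromℕ-mono-< : ∀ {m n} → m ℕ.< n → fromℕ m < fromℕ n
  fromℕ-mono-< {m} p = <-≤-trans (≤-<-trans (inj₂ (R.sym (R.+-identityˡ _))) (+-monoˡ-< (fromℕ m) 0<1))
      (fromℕ-mono-≤ p)

  fromℕ-cancel-≤ : ∀ {m n} → fromℕ m ≤ fromℕ n → m ℕ.≤ n
  fromℕ-cancel-≤ p = ℕ.≮⇒≥ λ q → ≤⇒≯ p (fromℕ-mono-< q)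

  fromℕ-cancel-< : ∀ {m n} → fromℕ m < fromℕ n → m ℕ.< n
  fromℕ-cancel-< p = ℕ.≰⇒> λ q → ≤⇒≯ (fromℕ-mono-≤ q) p

  -- Quadratic forms

  dot : ∀ {n} → Vector Carrier n → Vector Carrier n → Carrier
  dot u v = ∑ λ i → u i * v i

  mv : ∀ {m n} → (Fin m → Vector Carrier n) → Vector Carrier n → Vector Carrier m
  mv H v i = dot (H i) v

  form : ∀ {n} → Matrix n → Vector Carrier n → Vector Carrier n → Carrier
  form H u v = dot u (mv H v)

  Symmetric : ∀ {n} → Matrix n → Set
  Symmetric H = ∀ i j → H i j ≈ H j i

  module _ {n : ℕ} where

    dot-congʳ : ∀ (u : Vector Carrier n) {v w} → (∀ i → v i ≈ w i) → dot u v ≈ dot u w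
    dot-congʳ u p = sum-cong-≋ λ i → R.*-congˡ (p i)

    dot-congˡ : ∀ {u v : Vector Carrier n} w → (∀ i → u i ≈ v i) → dot u w ≈ dot v w
    dot-congˡ w p = sum-cong-≋ λ i → R.*-congʳ (p i)

    dot-comm : ∀ (u v : Vector Carrier n) → dot u v ≈ dot v u
    dot-comm u v = sum-cong-≋ λ i → R.*-comm (u i) (v i)

    dot-*ʳ : ∀ (u : Vector Carrier n) a v → dot u (λ i → a * v i) ≈ a * dot u v
    dot-*ʳ u a v = R.trans
      (sum-cong-≋ λ i → solve 3 (λ u a v → u :* (a :* v) := a :* (u :* v)) R.refl (u i) a (v i))
      (R.sym (*-distribˡ-sum a λ i → u i * v i))

    dot-+ʳ : ∀ (u v w : Vector Carrier n) → dot u (λ i → v i + w i) ≈ dot u v + dot u w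
    dot-+ʳ u v w = R.trans (sum-cong-≋ λ i → R.distribˡ (u i) (v i) (w i))
      (∑-distrib-+ (λ i → u i * v i) (λ i → u i * w i))

    dot-linearʳ : ∀ (u : Vector Carrier n) a v b w →
                  dot u (λ i → a * v i + b * w i) ≈ a * dot u v + b * dot u w
    dot-linearʳ u a v b w = R.trans (dot-+ʳ u (λ i → a * v i) (λ i → b * w i))
      (R.+-cong (dot-*ʳ u a v) (dot-*ʳ u b w))

    dot-linearˡ : ∀ a (v : Vector Carrier n) b w u →
                  dot (λ i → a * v i + b * w i) u ≈ a * dot v u + b * dot w u
    dot-linearˡ a v b w u = R.trans (dot-comm _ u) (R.trans (dot-linearʳ u a v b w)
      (R.+-cong (R.*-congˡ (dot-comm u v)) (R.*-congˡ (dot-comm u w))))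

    dot-zeroʳ : ∀ (u : Vector Carrier n) {v} → (∀ i → v i ≈ 0#) → dot u v ≈ 0#
    dot-zeroʳ u {v} p = R.trans (dot-congʳ u λ i → R.trans (p i) (R.sym (R.zeroˡ 0#)))
      (R.trans (dot-*ʳ u 0# (λ _ → 0#)) (R.zeroˡ _))

    form-symmetric : ∀ (H : Matrix n) → Symmetric H → ∀ u v → form H u v ≈ form H v u
    form-symmetric H H-sym u v = begin
      ∑ (λ i → u i * ∑ λ j → H i j * v j)     ≈⟨ sum-cong-≋ (λ i → *-distribˡ-sum (u i) λ j → H i j * v j) ⟩
      ∑ (λ i → ∑ λ j → u i * (H i j * v j))   ≈⟨ ∑-comm (λ i j → u i * (H i j * v j)) ⟩
      ∑ (λ j → ∑ λ i → u i * (H i j * v j))   ≈⟨ sum-cong-≋ (λ j → sum-cong-≋ λ i → R.trans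
                                                   (R.*-congˡ (R.*-congʳ (H-sym i j)))
                                                   (solve 3 (λ u h v → u :* (h :* v) := v :* (h :* u)) R.refl
                                                       (u i) (H j i) (v j))) ⟩
      ∑ (λ j → ∑ λ i → v j * (H j i * u i))   ≈⟨ sum-cong-≋ (λ j → *-distribˡ-sum (v j) λ i → H j i * u i) ⟨
      ∑ (λ j → v j * ∑ λ i → H j i * u i)     ∎
      where open ≈-Reasoning

    form-linearʳ : ∀ (H : Matrix n) u a v b w →
                   form H u (λ i → a * v i + b * w i) ≈ a * form H u v + b * form H u w
    form-linearʳ H u a v b w = R.trans (dot-congʳ u λ i → dot-linearʳ (H i) a v b w)
      (dot-linearʳ u a (mv H v) b (mv H w))

    form-linearˡ : ∀ (H : Matrix n) a u b v w →
                   form H (λ i → a * u i + b * v i) w ≈ a * form H u w + b * form H v w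
    form-linearˡ H a u b v w = dot-linearˡ a u b v (mv H w)

    form-square : ∀ (H : Matrix n) → Symmetric H → ∀ a u b v →
                  let w = λ i → a * u i + b * v i in
                  form H w w ≈ a * a * form H u u + fromℕ 2 * a * b * form H u v + b * b * form H v v
    form-square H H-sym a u b v = begin
      form H w w                               ≈⟨ form-linearˡ H a u b v w ⟩
      a * form H u w + b * form H v w
        ≈⟨ R.+-cong (R.*-congˡ (form-linearʳ H u a u b v))
        (R.*-congˡ
        (R.trans (form-linearʳ H v a u b v) (R.+-congʳ (R.*-congˡ (form-symmetric H H-sym v u))))) ⟩
      a * (a * form H u u + b * form H u v) + b * (a * form H u v + b * form H v v)
        ≈⟨ solve 5 (λ a b x y z → a :* (a :* x :+ b :* y) :+ b :* (a :* y :+ b :* z) :=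
                     a :* a :* x :+ con (+ 2) :* a :* b :* y :+ b :* b :* z) R.refl a b _ _ _ ⟩
      a * a * form H u u + fromℕ 2 * a * b * form H u v + b * b * form H v v ∎
      where
      open ≈-Reasoning
      w = λ i → a * u i + b * v i

    -- The same rank-one update serves as Schur complement, as removal of an eigenvector, and,
    -- started from the zero matrix, as a builder of differences of squares.
    deflate : Matrix n → Carrier → Vector Carrier n → Matrix n
    deflate H κ u i j = H i j - κ * u i * u j

    mv-deflate : ∀ H κ u x i → mv (deflate H κ u) x i ≈ mv H x i - κ * dot u x * u i
    mv-deflate H κ u x i = begin
      ∑ (λ j → (H i j - κ * u i * u j) * x j)
        ≈⟨ sum-cong-≋
            (λ j → solve 5
            (λ h κ a b x → (h :- κ :* a :* b) :* x := x :* (con (+ 1) :* h :+ (:- (κ :* a) :* b))) R.refl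
            (H i j) κ (u i) (u j) (x j)) ⟩
      dot x (λ j → fromℕ 1 * H i j + - (κ * u i) * u j)
        ≈⟨ dot-linearʳ x (fromℕ 1) (H i) (- (κ * u i)) u ⟩
      fromℕ 1 * dot x (H i) + - (κ * u i) * dot x u
        ≈⟨ R.+-cong (R.*-congˡ (dot-comm x (H i))) (R.*-congˡ (dot-comm x u)) ⟩
      fromℕ 1 * mv H x i + - (κ * u i) * dot u x
        ≈⟨ solve 4 (λ h κ a d → con (+ 1) :* h :+ (:- (κ :* a)) :* d := h :- κ :* d :* a) R.refl (mv H x i) κ
            (u i) (dot u x) ⟩
      mv H x i - κ * dot u x * u i ∎
      where open ≈-Reasoning

    form-deflate : ∀ H κ u x y → form (deflate H κ u) x y ≈ form H x y - κ * (dot u x * dot u y)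
    form-deflate H κ u x y = begin
      dot x (mv (deflate H κ u) y)   ≈⟨ dot-congʳ x (λ i → R.trans (mv-deflate H κ u y i)
                                           (solve 4 (λ h κ d a → h :- κ :* d :* a := con (+ 1) :* h :+ :-
                                               (κ :* d) :* a) R.refl (mv H y i) κ (dot u y) (u i))) ⟩
      dot x (λ i → fromℕ 1 * mv H y i + - (κ * dot u y) * u i)   ≈⟨ dot-linearʳ x _ (mv H y) _ u ⟩
      fromℕ 1 * form H x y + - (κ * dot u y) * dot x u           ≈⟨ R.+-congˡ (R.*-congˡ (dot-comm x u)) ⟩
      fromℕ 1 * form H x y + - (κ * dot u y) * dot u x
        ≈⟨ solve 4 (λ f κ d e → con (+ 1) :* f :+ :- (κ :* d) :* e := f :- κ :* (e :* d)) R.refl _ κ _ _ ⟩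
      form H x y - κ * (dot u x * dot u y) ∎
      where open ≈-Reasoning

    deflate-symmetric : ∀ {H} → Symmetric H → ∀ κ u → Symmetric (deflate H κ u)
    deflate-symmetric H-sym κ u i j = R.+-cong (H-sym i j)
      (R.-‿cong (solve 3 (λ κ a b → κ :* a :* b := κ :* b :* a) R.refl κ (u i) (u j)))

  dot-nonneg : ∀ {n} (v : Vector Carrier n) → 0# ≤ dot v v
  dot-nonneg {zero}  v = ≤.refl
  dot-nonneg {suc n} v = +-nonneg (sq-nonneg (v zero)) (dot-nonneg (tail v))

  dot-pos : ∀ {n} {v : Vector Carrier n} → NonzeroVector v → 0# < dot v v
  dot-pos {v = v} (zero  , v≉0) = +-pos-nonneg (sq-pos v≉0) (dot-nonneg (tail v))
  dot-pos {v = v} (suc i , v≉0) = <-≤-trans (+-pos-nonneg (dot-pos (i , v≉0)) (sq-nonneg (v zero)))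
      (inj₂ (R.+-comm _ _))

  dot≤0⇒≈0 : ∀ {n} {v : Vector Carrier n} → dot v v ≤ 0# → ∀ i → v i ≈ 0#
  dot≤0⇒≈0 {v = v} p i with compare (v i) 0#
  ... | tri< _ q _ = ⊥-elim (≤⇒≯ p (dot-pos (i , q)))
  ... | tri≈ _ q _ = q
  ... | tri> _ q _ = ⊥-elim (≤⇒≯ p (dot-pos (i , q)))

  difference-nonneg⇒≤ : ∀ {x y z} → 0# ≤ z → y - x ≈ z → x ≤ y
  difference-nonneg⇒≤ p q = 0≤-⇒≤ (≤.trans p (inj₂ (R.sym q)))

  -- A crude Cauchy-Schwarz from (ab + k)² ≤ 2(ab)² + 2k², one coordinate at a time. Its constant is
  -- irrelevant: it only has to make Rayleigh quotients bounded and definiteness survive a change of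
  -- variables.
  dot²-bounded : ∀ {n} (l : Vector Carrier n) →
                 ∃[ L ] (0# ≤ L × ∀ y → dot l y * dot l y ≤ L * dot y y)
  dot²-bounded {zero}  l = 0# , ≤.refl , λ _ → inj₂ R.refl
  dot²-bounded {suc n} l with dot²-bounded (tail l)
  ... | L , 0≤L , bound = two * a² + two * L , +-nonneg (*-nonneg 0≤2 0≤a²) (*-nonneg 0≤2 0≤L) , λ y →
    let k = dot (tail l) (tail y); D = dot (tail y) (tail y); b = y zero in
    difference-nonneg⇒≤ (+-nonneg (+-nonneg (*-nonneg 0≤2 (≤⇒0≤- (bound (tail y)))) (sq-nonneg (a * b - k)))
                  (+-nonneg (*-nonneg 0≤2 (*-nonneg 0≤L (sq-nonneg b)))
                      (*-nonneg 0≤2 (*-nonneg 0≤a² (dot-nonneg (tail y))))))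
        (solve 5 (λ a b k L D →
            (con (+ 2) :* (a :* a) :+ con (+ 2) :* L) :* (b :* b :+ D) :- (a :* b :+ k) :* (a :* b :+ k) :=
            con (+ 2) :* (L :* D :- k :* k) :+ (a :* b :- k) :* (a :* b :- k) :+
            (con (+ 2) :* (L :* (b :* b)) :+ con (+ 2) :* (a :* a :* D))) R.refl a b k L D)
    where
    a = l zero
    a² = a * a
    0≤a² = sq-nonneg a
    two = fromℕ 2
    0≤2 : 0# ≤ two
    0≤2 = fromℕ-nonneg 2

  mv-bounded : ∀ {m n} (H : Fin m → Vector Carrier n) →
               ∃[ K ] (∀ x → dot (mv H x) (mv H x) ≤ K * dot x x)
  mv-bounded {zero}  H = 0# , λ x → inj₂ (R.sym (R.zeroˡ _))
  mv-bounded {suc m} H with dot²-bounded (H zero) | mv-bounded (tail H)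
  ... | L , _ , p | K , q = L + K , λ x → ≤.trans (+-mono-≤ (p x) (q x)) (inj₂ (R.sym (R.distribʳ _ _ _)))

  dot≤squares : ∀ {n} (u v : Vector Carrier n) → dot u v ≤ dot u u + dot v v
  dot≤squares {zero}  u v = +-nonneg ≤.refl ≤.refl
  dot≤squares {suc n} u v = ≤.trans (+-mono-≤ head≤ (dot≤squares (tail u) (tail v)))
    (inj₂ (solve 4 (λ a b c d → (a :+ b) :+ (c :+ d) := (a :+ c) :+ (b :+ d)) R.refl _ _ _ _))
    where
    x = u zero
    y = v zero
    head≤ : x * y ≤ x * x + y * y
    head≤ with compare (x * y) 0#
    ... | tri< p _ _ = ≤.trans (inj₁ p) (+-nonneg (sq-nonneg x) (sq-nonneg y))
    ... | tri≈ _ p _ = ≤.trans (inj₂ p) (+-nonneg (sq-nonneg x) (sq-nonneg y))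
    ... | tri> _ _ p = difference-nonneg⇒≤ (+-nonneg (sq-nonneg (x - y)) (inj₁ p))
      (solve 2 (λ x y → (x :* x :+ y :* y) :- x :* y := (x :- y) :* (x :- y) :+ x :* y) R.refl x y)

  form-bounded : ∀ {n} (H : Matrix n) → ∃[ K ] (∀ x → form H x x ≤ K * dot x x)
  form-bounded H with mv-bounded H
  ... | K , p = fromℕ 1 + K , λ x → ≤.trans (dot≤squares x (mv H x)) (≤.trans (+-monoʳ-≤ _ (p x))
    (inj₂ (solve 2 (λ d K → d :+ K :* d := (con (+ 1) :+ K) :* d) R.refl (dot x x) K)))

  -- Positive semidefinite forms

  Kernel : ∀ {n} → Matrix n → Set
  Kernel M = ∃[ v ] (NonzeroVector v × ∀ i → mv M v i ≈ 0#)

  ≈-stable : ∀ {x y} → ¬ ¬ (x ≈ y) → x ≈ y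
  ≈-stable {x} {y} ¬¬p with compare x y
  ... | tri< _ ¬p _ = ⊥-elim (¬¬p ¬p)
  ... | tri≈ _ p _  = p
  ... | tri> _ ¬p _ = ⊥-elim (¬¬p ¬p)

  affine-nonneg⇒constant : ∀ {β κ} → (∀ t → 0# ≤ t * β + κ) → β ≈ 0#
  affine-nonneg⇒constant {β} {κ} p = ≈-stable λ β≉0 →
    -- At this t the affine function takes the value -1.
    ≤⇒≯ (p (β ⁻¹ * (- κ - 1#))) (0<-⇒< (<-≤-trans 0<1 (inj₂ (R.sym (begin
      0# - (β ⁻¹ * (- κ - 1#) * β + κ)
        ≈⟨ solve 4 (λ β b κ o → con (+ 0) :- (b :* (:- κ :- o) :* β :+ κ) := β :* b :* (κ :+ o) :- κ) R.refl β
        (β ⁻¹) κ 1# ⟩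
      β * β ⁻¹ * (κ + 1#) - κ             ≈⟨ R.+-congʳ (R.*-congʳ (⁻¹-inverseʳ β≉0)) ⟩
      1# * (κ + 1#) - κ                   ≈⟨ R.+-congʳ (R.*-identityˡ _) ⟩
      κ + 1# - κ                          ≈⟨ solve 2 (λ κ o → κ :+ o :- κ := o) R.refl κ 1# ⟩
      1#                                  ∎)))))
    where open ≈-Reasoning

  form-∷ : ∀ {n} (M : Matrix (suc n)) → Symmetric M → ∀ x y → let b = tail (M zero); M′ = λ i j → M (suc i) (suc j) in
           form M (x ∷ᶠ y) (x ∷ᶠ y) ≈ M zero zero * (x * x) + fromℕ 2 * (x * dot b y) + form M′ y y
  form-∷ M M-sym x y = begin
    x * (a * x + dot b y) + dot y (λ i → M (suc i) zero * x + mv M′ y i)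
      ≈⟨ R.+-congˡ (dot-congʳ y λ i → R.trans (R.+-congʳ (R.*-congʳ (M-sym (suc i) zero)))
           (solve 3 (λ m x r → m :* x :+ r := x :* m :+ con (+ 1) :* r) R.refl (b i) x (mv M′ y i))) ⟩
    x * (a * x + dot b y) + dot y (λ i → x * b i + fromℕ 1 * mv M′ y i)
      ≈⟨ R.+-congˡ (R.trans (dot-linearʳ y x b (fromℕ 1) (mv M′ y)) (R.+-congʳ (R.*-congˡ (dot-comm y b)))) ⟩
    x * (a * x + dot b y) + (x * dot b y + fromℕ 1 * form M′ y y)
      ≈⟨ solve 4
          (λ a x d f → x :* (a :* x :+ d) :+ (x :* d :+ con (+ 1) :* f) := a :* (x :* x) :+ con (+ 2) :*
          (x :* d) :+ f) R.refl a x _ _ ⟩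
    a * (x * x) + fromℕ 2 * (x * dot b y) + form M′ y y ∎
    where
    open ≈-Reasoning
    a = M zero zero
    b = tail (M zero)
    M′ = λ i j → M (suc i) (suc j)

  form-zeroʳ : ∀ {n} (M : Matrix n) u {v} → (∀ i → v i ≈ 0#) → form M u v ≈ 0#
  form-zeroʳ M u p = dot-zeroʳ u λ i → dot-zeroʳ (M i) p

  -- Completing the square in the first variable reduces the dimension by one.
  psd-singular-or-definite : ∀ {n} (M : Matrix n) → Symmetric M → (∀ x → 0# ≤ form M x x) →
    Kernel M ⊎ ∃[ ε ] (0# < ε × ∀ x → ε * dot x x ≤ form M x x)
  psd-singular-or-definite {zero} M _ _ = inj₂ (1# , 0<1 , λ _ → inj₂ (R.zeroʳ 1#))
  psd-singular-or-definite {suc n} M M-sym psd = by-sign (compare a 0#)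
    where
    a = M zero zero
    b = tail (M zero)
    M′ : Matrix n
    M′ = λ i j → M (suc i) (suc j)
    zeros : Vector Carrier n
    zeros _ = 0#

    psd-∷ : ∀ x y → 0# ≤ a * (x * x) + fromℕ 2 * (x * dot b y) + form M′ y y
    psd-∷ x y = ≤.trans (psd (x ∷ᶠ y)) (inj₂ (form-∷ M M-sym x y))

    a≮0 : ¬ (a < 0#)
    a≮0 a<0 = ≤⇒≯ (psd-∷ 1# zeros) (≤-<-trans (inj₂ (begin
      a * (1# * 1#) + fromℕ 2 * (1# * dot b zeros) + form M′ zeros zeros
        ≈⟨ R.+-cong
            (R.+-cong (R.*-congˡ (R.*-identityˡ 1#)) (R.*-congˡ (R.*-congˡ (dot-zeroʳ b λ _ → R.refl))))
            (form-zeroʳ M′ zeros λ _ → R.refl) ⟩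
      a * 1# + fromℕ 2 * (1# * 0#) + 0#
        ≈⟨ R.+-cong (R.+-cong (R.*-identityʳ a) (R.*-congˡ (R.zeroʳ 1#))) R.refl ⟩
      a + fromℕ 2 * 0# + 0# ≈⟨ solve 1 (λ a → a :+ con (+ 2) :* con (+ 0) :+ con (+ 0) := a) R.refl a ⟩
      a ∎)) a<0)
      where open ≈-Reasoning

    -- With a = 0 the form at (t, b) is affine in t with slope 2 b·b, and semidefiniteness forces
    -- the slope to vanish. So the whole first row is zero and the first basis vector lies in the
    -- kernel.
    isotropic : a ≈ 0# → Kernel M
    isotropic a≈0 = 1# ∷ᶠ zeros , (zero , pos⇒≉0 0<1) , λ where
        zero    → R.trans (R.+-cong (R.trans (R.*-identityʳ a) a≈0) (dot-zeroʳ b λ _ → R.refl))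
            (R.+-identityˡ 0#)
        (suc i) → R.trans
            (R.+-cong (R.trans (R.*-identityʳ _) (R.trans (M-sym (suc i) zero) (b≈0 i)))
            (dot-zeroʳ (M′ i) λ _ → R.refl)) (R.+-identityˡ 0#)
      where
      b≈0 : ∀ i → b i ≈ 0#
      b≈0 = dot≤0⇒≈0 (inj₂ (*-integral (pos⇒≉0 (fromℕ-pos {2} (ℕ.s≤s ℕ.z≤n)))
        (affine-nonneg⇒constant λ t → ≤.trans (psd-∷ t b) (inj₂ (R.+-congʳ (begin
          a * (t * t) + fromℕ 2 * (t * dot b b)  ≈⟨ R.+-congʳ (R.trans (R.*-congʳ a≈0) (R.zeroˡ _)) ⟩
          0# + fromℕ 2 * (t * dot b b)
            ≈⟨ solve 2 (λ t d → con (+ 0) :+ con (+ 2) :* (t :* d) := t :* (con (+ 2) :* d)) R.refl t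
            (dot b b) ⟩
          t * (fromℕ 2 * dot b b)                ∎))))))
        where open ≈-Reasoning

    by-sign : Tri (a < 0#) (a ≈ 0#) (0# < a) → Kernel M ⊎ ∃[ ε ] (0# < ε × ∀ x → ε * dot x x ≤ form M x x)
    by-sign (tri< a<0 _ _) = ⊥-elim (a≮0 a<0)
    by-sign (tri≈ _ a≈0 _) = inj₁ (isotropic a≈0)
    by-sign (tri> _ _ 0<a) = lift-schur
        (psd-singular-or-definite S (deflate-symmetric (λ i j → M-sym (suc i) (suc j)) α b) S-psd)
      where
      open ≈-Reasoning
      α = a ⁻¹
      aα≈1 = ⁻¹-inverseʳ (pos⇒≉0 0<a)
      -- The Schur complement of `a`. Its form is that of `M` at the x that makes the completed
      -- square vanish, x = -b·y / a; the same x lifts kernel vectors of `S` to kernel vectors of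
      -- `M`.
      S = deflate M′ α b

      square : ∀ x y → form M (x ∷ᶠ y) (x ∷ᶠ y) ≈ a * ((x + α * dot b y) * (x + α * dot b y)) + form S y y
      square x y = begin
        form M (x ∷ᶠ y) (x ∷ᶠ y)   ≈⟨ form-∷ M M-sym x y ⟩
        a * (x * x) + fromℕ 2 * (x * d) + f
          ≈⟨ solve 4
              (λ a x d f → a :* (x :* x) :+ con (+ 2) :* (x :* d) :+ f := a :* (x :* x) :+ con (+ 1) :*
              (con (+ 2) :* (x :* d)) :+ f) R.refl a x d f ⟩
        a * (x * x) + fromℕ 1 * (fromℕ 2 * (x * d)) + f
          ≈⟨ R.+-congʳ (R.+-congˡ (R.*-congʳ (R.trans (R.+-identityʳ 1#) (R.sym aα≈1)))) ⟩
        a * (x * x) + a * α * (fromℕ 2 * (x * d)) + f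
          ≈⟨ solve 5 (λ a α x d f → a :* (x :* x) :+ a :* α :* (con (+ 2) :* (x :* d)) :+ f :=
               a :* ((x :+ α :* d) :* (x :+ α :* d)) :+ (f :- a :* α :* (α :* (d :* d)))) R.refl a α x d f ⟩
        a * ((x + α * d) * (x + α * d)) + (f - a * α * (α * (d * d)))
          ≈⟨ R.+-congˡ (R.+-congˡ (R.-‿cong (R.trans (R.*-congʳ aα≈1) (R.*-identityˡ _)))) ⟩
        a * ((x + α * d) * (x + α * d)) + (f - α * (d * d))
          ≈⟨ R.+-congˡ (form-deflate M′ α b y y) ⟨
        a * ((x + α * d) * (x + α * d)) + form S y y ∎
        where
        d = dot b y
        f = form M′ y y

      S-psd : ∀ y → 0# ≤ form S y y
      S-psd y = ≤.trans (psd (- (α * dot b y) ∷ᶠ y)) (inj₂ (R.trans (square _ y)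
        (solve 3 (λ a k s → a :* ((:- k :+ k) :* (:- k :+ k)) :+ s := s) R.refl a (α * dot b y)
            (form S y y))))

      lift-schur : Kernel S ⊎ ∃[ ε ] (0# < ε × ∀ x → ε * dot x x ≤ form S x x) →
                   Kernel M ⊎ ∃[ ε ] (0# < ε × ∀ x → ε * dot x x ≤ form M x x)
      lift-schur (inj₁ (v , (i , vᵢ≉0) , Sv≈0)) = inj₁ (- (α * dot b v) ∷ᶠ v , (suc i , vᵢ≉0) , λ where
        zero → begin
          a * - (α * dot b v) + dot b v
            ≈⟨ solve 3 (λ a α d → a :* (:- (α :* d)) :+ d := d :- a :* α :* d) R.refl a α (dot b v) ⟩
          dot b v - a * α * dot b v
            ≈⟨ R.+-congˡ (R.-‿cong (R.trans (R.*-congʳ aα≈1) (R.*-identityˡ _))) ⟩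
          dot b v - dot b v                    ≈⟨ R.-‿inverseʳ _ ⟩
          0#                                   ∎
        (suc j) → begin
          M (suc j) zero * - (α * dot b v) + mv M′ v j  ≈⟨ R.+-congʳ (R.*-congʳ (M-sym (suc j) zero)) ⟩
          b j * - (α * dot b v) + mv M′ v j
            ≈⟨ solve 4 (λ b α d m → b :* (:- (α :* d)) :+ m := m :- α :* d :* b) R.refl (b j) α (dot b v)
            (mv M′ v j) ⟩
          mv M′ v j - α * dot b v * b j       ≈⟨ mv-deflate M′ α b v j ⟨
          mv S v j                            ≈⟨ Sv≈0 j ⟩
          0#                                  ∎)
      lift-schur (inj₂ (ε , 0<ε , definite)) = inj₂
          (ε′ , 0<ε′ , λ x → ≤.trans (bound (x zero) (tail x)) (inj₂ (R.sym (square (x zero) (tail x)))))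
        where
        L² = dot²-bounded b
        L = L² .proj₁
        two = fromℕ 2
        c = two * (α * α * L) + 1#
        0≤c : 0# ≤ two * (α * α * L)
        0≤c = *-nonneg (fromℕ-nonneg 2) (*-nonneg (sq-nonneg α) (L² .proj₂ .proj₁))
        D = two * ε + a * c
        0<aε = *-pos 0<a 0<ε
        0<ac = *-pos 0<a (<-≤-trans (+-pos-nonneg 0<1 0≤c) (inj₂ (R.+-comm _ _)))
        0<D : 0# < D
        0<D = <-≤-trans (+-pos-nonneg 0<ac (*-nonneg (fromℕ-nonneg 2) (inj₁ 0<ε))) (inj₂ (R.+-comm _ _))
        -- A harmonic substitute for the minimum of a/2 and ε/c: with D = 2ε + ac both 2ε′ ≤ a and
        -- cε′ ≤ ε hold. The constant c collects the |y|² terms that arise when x² is estimated by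
        -- (x + k)².
        ε′ = a * ε * D ⁻¹
        0<ε′ = *-pos 0<aε (⁻¹-pos 0<D)
        Dε′≈aε : D * ε′ ≈ a * ε
        Dε′≈aε = R.trans (solve 3 (λ D x y → D :* (x :* y) := D :* y :* x) R.refl D (a * ε) (D ⁻¹))
                   (R.trans (R.*-congʳ (⁻¹-inverseʳ (pos⇒≉0 0<D))) (R.*-identityˡ _))
        2ε′≤a : two * ε′ ≤ a
        2ε′≤a = *-cancelˡ-≤ 0<ε (difference-nonneg⇒≤ (*-nonneg (inj₁ 0<ac) (inj₁ 0<ε′)) (begin
          ε * a - ε * (two * ε′)                    ≈⟨ R.+-congʳ (R.trans (R.*-comm ε a) (R.sym Dε′≈aε)) ⟩
          D * ε′ - ε * (two * ε′)
            ≈⟨ solve 4 (λ ε e a c → (con (+ 2) :* ε :+ a :* c) :* e :- ε :* (con (+ 2) :* e) := a :* c :* e)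
            R.refl ε ε′ a c ⟩
          a * c * ε′ ∎))
        cε′≤ε : c * ε′ ≤ ε
        cε′≤ε = *-cancelˡ-≤ 0<a
            (difference-nonneg⇒≤ (*-nonneg (*-nonneg (fromℕ-nonneg 2) (inj₁ 0<ε)) (inj₁ 0<ε′)) (begin
          a * ε - a * (c * ε′)                      ≈⟨ R.+-congʳ (R.sym Dε′≈aε) ⟩
          D * ε′ - a * (c * ε′)
            ≈⟨ solve 4 (λ ε e a c → (con (+ 2) :* ε :+ a :* c) :* e :- a :* (c :* e) := con (+ 2) :* ε :* e)
            R.refl ε ε′ a c ⟩
          two * ε * ε′ ∎))

        -- x² ≤ 2 (x + k)² + 2 k² for the linear form k = b·y / a, whose square is at most a⁻² L |y|².
        bound : ∀ x y → ε′ * (x * x + dot y y) ≤ a * ((x + α * dot b y) * (x + α * dot b y)) + form S y y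
        bound x y = difference-nonneg⇒≤
          (+-nonneg (+-nonneg (+-nonneg
            (*-nonneg (≤⇒0≤- 2ε′≤a) (sq-nonneg (x + k)))
            (*-nonneg (≤⇒0≤- cε′≤ε) (dot-nonneg y)))
            (≤⇒0≤- (definite y)))
            (*-nonneg (inj₁ 0<ε′)
                (+-nonneg (sq-nonneg (x + k + k))
                (*-nonneg (*-nonneg (fromℕ-nonneg 2) (sq-nonneg α)) (≤⇒0≤- (L² .proj₂ .proj₂ y))))))
          (R.trans (R.+-congˡ (R.-‿cong (R.*-congˡ (R.sym (R.+-congˡ (R.*-identityˡ (dot y y)))))))
           (solve 10 (λ a x α d f e Y L ε o →
             let k = α :* d; X = x :+ k in
             (a :* (X :* X) :+ f) :- e :* (x :* x :+ o :* Y) :=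
             (a :- con (+ 2) :* e) :* (X :* X) :+ (ε :- (con (+ 2) :* (α :* α :* L) :+ o) :* e) :* Y :+
                 (f :- ε :* Y) :+
             e :* ((X :+ k) :* (X :+ k) :+ con (+ 2) :* (α :* α) :* (L :* Y :- d :* d)))
             R.refl a x α (dot b y) (form S y y) ε′ (dot y y) L ε 1#))
          where k = α * dot b y

  -- The top eigenvalue and reverse Cauchy-Schwarz

  δ : ∀ {n} → Matrix n
  δ zero    zero    = 1#
  δ zero    (suc j) = 0#
  δ (suc i) zero    = 0#
  δ (suc i) (suc j) = δ i j

  dot-δ : ∀ {n} i (v : Vector Carrier n) → dot (δ i) v ≈ v i
  dot-δ zero    v = R.trans
      (R.+-cong (R.*-identityˡ _) (R.trans (dot-comm _ (tail v)) (dot-zeroʳ (tail v) λ _ → R.refl)))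
      (R.+-identityʳ _)
  dot-δ (suc i) v = R.trans (R.+-cong (R.zeroˡ _) (dot-δ i (tail v))) (R.+-identityˡ _)

  δ-symmetric : ∀ {n} → Symmetric (δ {n})
  δ-symmetric zero    zero    = R.refl
  δ-symmetric zero    (suc j) = R.refl
  δ-symmetric (suc i) zero    = R.refl
  δ-symmetric (suc i) (suc j) = δ-symmetric i j

  form-δ : ∀ {n} (H : Matrix n) i j → form H (δ i) (δ j) ≈ H i j
  form-δ H i j = R.trans (dot-δ i (mv H (δ j))) (R.trans (dot-comm (H i) (δ j)) (dot-δ j (H i)))

  δ-nonzero : ∀ {n} (i : Fin n) → NonzeroVector (δ i)
  δ-nonzero i = i , λ p → pos⇒≉0 0<1 (R.trans (R.sym (δ-diagonal i)) p)
    where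
    δ-diagonal : ∀ {n} (i : Fin n) → δ i i ≈ 1#
    δ-diagonal zero    = R.refl
    δ-diagonal (suc i) = δ-diagonal i

  -- The supremum of the Rayleigh quotients is attained because λ′ I − H is positive semidefinite but not definite.
  top-eigenvalue : ∀ {n} (H : Matrix (suc n)) → Symmetric H →
    ∃[ λ′ ] (Eigenvalue H λ′ × ∀ x → form H x x ≤ λ′ * dot x x)
  top-eigenvalue {n} H H-sym = top , eigen (psd-singular-or-definite M M-sym M-psd) , rayleigh
    where
    open ≈-Reasoning
    P : Pred Carrier 0ℓ
    -- The lower bounds of Rayleigh quotients rather than the quotients: the supremum is the same
    -- and membership needs no division.
    P μ = ∃[ x ] (0# < dot x x × μ * dot x x ≤ form H x x)

    attained : ∀ x → 0# < dot x x → P (form H x x * dot x x ⁻¹)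
    attained x p = x , p , inj₂ (begin
      form H x x * dot x x ⁻¹ * dot x x
        ≈⟨ solve 3 (λ f d e → f :* e :* d := d :* e :* f) R.refl (form H x x) (dot x x) (dot x x ⁻¹) ⟩
      dot x x * dot x x ⁻¹ * form H x x     ≈⟨ R.*-congʳ (⁻¹-inverseʳ (pos⇒≉0 p)) ⟩
      1# * form H x x                       ≈⟨ R.*-identityˡ _ ⟩
      form H x x                            ∎)

    inhabited : ∃ P
    inhabited = form H e₀ e₀ * dot e₀ e₀ ⁻¹ , attained e₀ (dot-pos {v = e₀} (δ-nonzero zero))
      where
      e₀ : Vector Carrier (suc n)
      e₀ = δ zero

    cancel : ∀ {μ K} x → 0# < dot x x → μ * dot x x ≤ K * dot x x → μ ≤ K
    cancel x p q = *-cancelˡ-≤ p (≤.trans (inj₂ (R.*-comm _ _)) (≤.trans q (inj₂ (R.*-comm _ _))))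

    bounded : ∃ (UpperBound P)
    bounded = form-bounded H .proj₁ , λ (x , 0<x , q) → cancel x 0<x (≤.trans q (form-bounded H .proj₂ x))

    top = sup P

    rayleigh : ∀ x → form H x x ≤ top * dot x x
    rayleigh x with compare 0# (dot x x)
    ... | tri< p _ _ = ≤.trans (inj₂ (begin
      form H x x                            ≈⟨ R.*-identityˡ _ ⟨
      1# * form H x x                       ≈⟨ R.*-congʳ (⁻¹-inverseʳ (pos⇒≉0 p)) ⟨
      dot x x * dot x x ⁻¹ * form H x x
        ≈⟨ solve 3 (λ f d e → d :* e :* f := f :* e :* d) R.refl (form H x x) (dot x x) (dot x x ⁻¹) ⟩
      form H x x * dot x x ⁻¹ * dot x x     ∎))
      (*-monoˡ-≤ (inj₁ p) (sup-upper inhabited bounded (attained x p)))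
    ... | tri≈ _ p _ = inj₂ (R.trans (form-zeroʳ H x (dot≤0⇒≈0 {v = x} (inj₂ (R.sym p)))) (R.sym (R.trans (R.*-congˡ (R.sym p)) (R.zeroʳ top))))
    ... | tri> _ _ p = ⊥-elim (≤⇒≯ (dot-nonneg x) p)

    M : Matrix (suc n)
    M i j = top * δ i j + - 1# * H i j

    mv-M : ∀ x i → mv M x i ≈ top * x i + - 1# * mv H x i
    mv-M x i = R.trans (dot-linearˡ top (δ i) (- 1#) (H i) x) (R.+-congʳ (R.*-congˡ (dot-δ i x)))

    form-M : ∀ x → form M x x ≈ top * dot x x - form H x x
    form-M x = R.trans (dot-congʳ x (mv-M x))
        (R.trans (dot-linearʳ x top x (- 1#) (mv H x)) (R.+-congˡ (RP.-1*x≈-x (form H x x))))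

    M-sym : Symmetric M
    M-sym i j = R.+-cong (R.*-congˡ (δ-symmetric i j)) (R.*-congˡ (H-sym i j))

    M-psd : ∀ x → 0# ≤ form M x x
    M-psd x = ≤.trans (≤⇒0≤- (rayleigh x)) (inj₂ (R.sym (form-M x)))

    eigen : Kernel M ⊎ ∃[ ε ] (0# < ε × ∀ x → ε * dot x x ≤ form M x x) → Eigenvalue H top
    eigen (inj₁ (v , v≉0 , Mv≈0)) = v , v≉0 , λ i → R.sym (RG.x∙y⁻¹≈ε⇒x≈y (top * v i) (mv H v i)
      (R.trans (R.+-congˡ (R.sym (RP.-1*x≈-x (mv H v i)))) (R.trans (R.sym (mv-M v i)) (Mv≈0 i))))
    -- Definiteness with constant ε would make `top - ε` an upper bound for the Rayleigh quotients
    -- as well.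
    eigen (inj₂ (ε , 0<ε , definite)) = ⊥-elim (≤⇒≯ (sup-least inhabited smaller)
      (0<-⇒< (<-≤-trans 0<ε (inj₂ (solve 2 (λ t e → e := t :- (t :- e)) R.refl top ε)))))
      where
      smaller : UpperBound P (top - ε)
      smaller {μ} (x , 0<x , q) = cancel x 0<x (≤.trans q (difference-nonneg⇒≤
        (≤⇒0≤- (≤.trans (definite x) (inj₂ (form-M x))))
        (solve 4 (λ t e d f → (t :- e) :* d :- f := t :* d :- f :- e :* d) R.refl top ε (dot x x)
            (form H x x))))

  -- Deflating the top eigenvector leaves a matrix whose top eigenvalue is the second one of H.
  rank-one-bound : ∀ {n} (H : Matrix (suc n)) → Symmetric H → AtMostOnePositiveEigenvalue H →
    ∃[ κ ] ∃[ p ] (∀ x → form H x x ≤ κ * (dot p x * dot p x))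
  rank-one-bound {n} H H-sym one = deflated (top-eigenvalue H H-sym)
    where
    deflated : ∃[ λ₁ ] (Eigenvalue H λ₁ × ∀ x → form H x x ≤ λ₁ * dot x x) →
               ∃[ κ ] ∃[ p ] (∀ x → form H x x ≤ κ * (dot p x * dot p x))
    deflated (λ₁ , (u , u≉0 , Hu≈λ₁u) , rayleigh) = κ , u , second (top-eigenvalue H′ H′-sym)
      where
      open ≈-Reasoning
      0<u² = dot-pos u≉0
      κ = λ₁ * dot u u ⁻¹
      H′ = deflate H κ u
      H′-sym = deflate-symmetric H-sym κ u

      κu²≈λ₁ : κ * dot u u ≈ λ₁
      κu²≈λ₁ = begin
        λ₁ * dot u u ⁻¹ * dot u u
          ≈⟨ solve 3 (λ l d e → l :* e :* d := d :* e :* l) R.refl λ₁ (dot u u) (dot u u ⁻¹) ⟩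
        dot u u * dot u u ⁻¹ * λ₁   ≈⟨ R.*-congʳ (⁻¹-inverseʳ (pos⇒≉0 0<u²)) ⟩
        1# * λ₁                     ≈⟨ R.*-identityˡ _ ⟩
        λ₁                          ∎

      H′u≈0 : ∀ i → mv H′ u i ≈ 0#
      H′u≈0 i = begin
        mv H′ u i                          ≈⟨ mv-deflate H κ u u i ⟩
        mv H u i - κ * dot u u * u i       ≈⟨ R.+-cong (Hu≈λ₁u i) (R.-‿cong (R.*-congʳ κu²≈λ₁)) ⟩
        λ₁ * u i - λ₁ * u i                ≈⟨ R.-‿inverseʳ _ ⟩
        0#                                 ∎

      second : ∃[ λ₂ ] (Eigenvalue H′ λ₂ × ∀ x → form H′ x x ≤ λ₂ * dot x x) →
               ∀ x → form H x x ≤ κ * (dot u x * dot u x)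
      second (λ₂ , (v , v≉0 , H′v≈λ₂v) , rayleigh′) x = 0≤-⇒≤ (≤.trans (neg-nonneg H′x≤0) (inj₂ (begin
          - form H′ x x                                    ≈⟨ R.-‿cong (form-deflate H κ u x x) ⟩
          - (form H x x - κ * (dot u x * dot u x))
            ≈⟨ solve 2 (λ a b → :- (a :- b) := b :- a) R.refl _ _ ⟩
          κ * (dot u x * dot u x) - form H x x             ∎)))
        where
        neg-nonneg : ∀ {y} → y ≤ 0# → 0# ≤ - y
        neg-nonneg p = ≤.trans (≤⇒0≤- p) (inj₂ (R.+-identityˡ _))

        -- Since H′u = 0, an eigenvector v of H′ for λ₂ > 0 is orthogonal to u, and is then an
        -- eigenvector of H for λ₂. The Rayleigh bound makes λ₁ positive too, so λ₁ = λ₂ by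
        -- uniqueness and u, v are dependent by simplicity, which is impossible for nonzero
        -- orthogonal vectors.
        λ₂≯0 : ¬ (0# < λ₂)
        λ₂≯0 0<λ₂ = dependent .proj₂ .proj₂ .proj₁ (a≈0 , b≈0)
          where
          0<v² = dot-pos v≉0
          u·v≈0 : dot u v ≈ 0#
          u·v≈0 = *-integral (pos⇒≉0 0<λ₂) (begin
            λ₂ * dot u v                   ≈⟨ dot-*ʳ u λ₂ v ⟨
            dot u (λ i → λ₂ * v i)         ≈⟨ dot-congʳ u H′v≈λ₂v ⟨
            form H′ u v                    ≈⟨ form-symmetric H′ H′-sym u v ⟩
            form H′ v u                    ≈⟨ dot-zeroʳ v H′u≈0 ⟩
            0#                             ∎)
          Hv≈λ₂v : ∀ i → mv H v i ≈ λ₂ * v i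
          Hv≈λ₂v i = begin
            mv H v i
              ≈⟨ solve 3 (λ m k u → m := m :- k :* con (+ 0) :* u) R.refl (mv H v i) κ (u i) ⟩
            mv H v i - κ * 0# * u i             ≈⟨ R.+-congˡ (R.-‿cong (R.*-congʳ (R.*-congˡ u·v≈0))) ⟨
            mv H v i - κ * dot u v * u i        ≈⟨ mv-deflate H κ u v i ⟨
            mv H′ v i                           ≈⟨ H′v≈λ₂v i ⟩
            λ₂ * v i                            ∎
          0<λ₁ : 0# < λ₁
          0<λ₁ = *-cancelˡ-pos 0<v² (<-≤-trans (*-pos 0<λ₂ 0<v²) (≤.trans
            (inj₂ (R.trans (R.sym (dot-*ʳ v λ₂ v)) (R.sym (dot-congʳ v Hv≈λ₂v))))
            (≤.trans (rayleigh v) (inj₂ (R.*-comm _ _)))))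
          open AtMostOnePositiveEigenvalue one
          λ₁≈λ₂ : λ₁ ≈ λ₂
          λ₁≈λ₂ = unique 0<λ₁ 0<λ₂ (u , u≉0 , Hu≈λ₁u) (v , v≉0 , Hv≈λ₂v)
          dependent : LinearlyDependent u v
          dependent = simple 0<λ₁ (u≉0 , Hu≈λ₁u) (v≉0 , λ i → R.trans (Hv≈λ₂v i) (R.*-congʳ (R.sym λ₁≈λ₂)))
          a = dependent .proj₁
          b = dependent .proj₂ .proj₁
          relation = dependent .proj₂ .proj₂ .proj₂
          a≈0 : a ≈ 0#
          a≈0 = *-integral (pos⇒≉0 0<u²) (begin
            dot u u * a
              ≈⟨ solve 3 (λ d a b → d :* a := a :* d :+ b :* con (+ 0)) R.refl (dot u u) a b ⟩
            a * dot u u + b * 0#                     ≈⟨ R.+-congˡ (R.*-congˡ u·v≈0) ⟨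
            a * dot u u + b * dot u v                ≈⟨ dot-linearʳ u a u b v ⟨
            dot u (λ i → a * u i + b * v i)          ≈⟨ dot-zeroʳ u relation ⟩
            0#                                       ∎)
          b≈0 : b ≈ 0#
          b≈0 = *-integral (pos⇒≉0 0<v²) (begin
            dot v v * b
              ≈⟨ solve 3 (λ d a b → d :* b := a :* con (+ 0) :+ b :* d) R.refl (dot v v) a b ⟩
            a * 0# + b * dot v v                     ≈⟨ R.+-congʳ (R.*-congˡ (R.trans (dot-comm v u) u·v≈0)) ⟨
            a * dot v u + b * dot v v                ≈⟨ dot-linearʳ v a u b v ⟨
            dot v (λ i → a * u i + b * v i)          ≈⟨ dot-zeroʳ v relation ⟩
            0#                                       ∎)

        H′x≤0 : form H′ x x ≤ 0#
        H′x≤0 = ≤.trans (rayleigh′ x) (≤.trans (*-monoˡ-≤ (dot-nonneg x) (≮⇒≥ λ₂≯0)) (inj₂ (R.zeroˡ _)))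

  -- The combination (p·v) u − (p·u) v is orthogonal to p, so H is nonpositive on it.
  reverse-cauchy-schwarz : ∀ {n} (H : Matrix (suc n)) → Symmetric H → AtMostOnePositiveEigenvalue H →
    ∀ u v → 0# < form H u u → form H u u * form H v v ≤ form H u v * form H u v
  reverse-cauchy-schwarz H H-sym one u v 0<Huu = from (rank-one-bound H H-sym one)
    where
    from : ∃[ κ ] ∃[ p ]
        (∀ x → form H x x ≤ κ * (dot p x * dot p x)) → form H u u * form H v v ≤ form H u v * form H u v
    from (κ , p , bound) = *-cancelˡ-≤ (sq-pos b≉0) (difference-nonneg⇒≤
        (+-nonneg (*-nonneg (inj₁ 0<Huu) (≤⇒0≤- Hww≤0)) (sq-nonneg (a * X + b * Y)))
        (R.trans (solve 5 (λ a b X Y Z → b :* b :* (Y :* Y) :- b :* b :* (X :* Z) :=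
            X :* (con (+ 0) :- (a :* a :* X :+ con (+ 2) :* a :* b :* Y :+ b :* b :* Z)) :+
                (a :* X :+ b :* Y) :* (a :* X :+ b :* Y)) R.refl a b X Y Z)
          (R.+-congʳ (R.*-congˡ (R.+-congˡ (R.-‿cong (R.sym (form-square H H-sym a u b v))))))))
      where
      open ≈-Reasoning
      X = form H u u
      Y = form H u v
      Z = form H v v
      a = dot p v
      b = - dot p u
      w = λ i → a * u i + b * v i

      b≉0 : ¬ (b ≈ 0#)
      b≉0 b≈0 = ≤⇒≯ (≤.trans (bound u) (inj₂ (begin
        κ * (dot p u * dot p u)
          ≈⟨ solve 2 (λ k d → k :* (d :* d) := k :* ((:- d) :* (:- d))) R.refl κ (dot p u) ⟩
        κ * (b * b)                    ≈⟨ R.*-congˡ (R.*-congʳ b≈0) ⟩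
        κ * (0# * b)                   ≈⟨ R.*-congˡ (R.zeroˡ b) ⟩
        κ * 0#                         ≈⟨ R.zeroʳ κ ⟩
        0#                             ∎))) 0<Huu

      Hww≤0 : form H w w ≤ 0#
      Hww≤0 = ≤.trans (bound w) (inj₂ (begin
        κ * (dot p w * dot p w)        ≈⟨ R.*-congˡ (R.*-congʳ (dot-linearʳ p a u b v)) ⟩
        κ * ((a * dot p u + b * dot p v) * dot p w)
          ≈⟨ solve 4 (λ k x y d → k :* ((x :* y :+ (:- y) :* x) :* d) := con (+ 0)) R.refl κ (dot p v)
          (dot p u) (dot p w) ⟩
        0#                             ∎))

  -- Inequalities between the entries of a positive matrix with one positive eigenvalue

  module PositiveOneEigenvalue {n} (H : Matrix (suc n)) (H-sym : Symmetric H) (H-pos : ∀ i j → 0# < H i j)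
    (one : AtMostOnePositiveEigenvalue H) where

    ⟨_·δ_+_·δ_⟩ : Carrier → Fin (suc n) → Carrier → Fin (suc n) → Vector Carrier (suc n)
    ⟨ a ·δ i + b ·δ j ⟩ k = a * δ i k + b * δ j k

    -- The diagonal contributions a² H_ii and b² H_jj are positive and may be dropped.
    cross-term≤ : ∀ {a b} i j → 0# < a → 0# < b → fromℕ 2 * a * b * H i j ≤ form H ⟨ a ·δ i + b ·δ j ⟩ ⟨ a ·δ i + b ·δ j ⟩
    cross-term≤ {a} {b} i j 0<a 0<b = difference-nonneg⇒≤
      (+-nonneg (*-nonneg (sq-nonneg a) (inj₁ (H-pos i i))) (*-nonneg (sq-nonneg b) (inj₁ (H-pos j j))))
          (begin
        form H w w - fromℕ 2 * a * b * H i j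
          ≈⟨ R.+-congʳ
              (R.trans (form-square H H-sym a (δ i) b (δ j))
              (R.+-cong (R.+-cong (R.*-congˡ (form-δ H i i)) (R.*-congˡ (form-δ H i j)))
              (R.*-congˡ (form-δ H j j)))) ⟩
        a * a * H i i + fromℕ 2 * a * b * H i j + b * b * H j j - fromℕ 2 * a * b * H i j
          ≈⟨ solve 3 (λ x y z → x :+ y :+ z :- y := x :+ z) R.refl _ _ _ ⟩
        a * a * H i i + b * b * H j j ∎)
      where
      open ≈-Reasoning
      w = ⟨ a ·δ i + b ·δ j ⟩

    private
      0<2 = fromℕ-pos {2} (ℕ.s≤s ℕ.z≤n)
      0<4 = fromℕ-pos {4} (ℕ.s≤s ℕ.z≤n)

    -- Reverse Cauchy-Schwarz for δ_i and w = H_ik δ_j + H_ij δ_k. These weights make both terms of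
    -- H(δ_i, w) equal to H_ij H_ik, while H(w, w) is at least 2 H_ij H_ik H_jk.
    three-term : ∀ i j k → H i i * H j k ≤ fromℕ 2 * (H i j * H i k)
    three-term i j k = *-cancelˡ-≤ (*-pos 0<2 (*-pos (H-pos i j) (H-pos i k))) (begin
      fromℕ 2 * (b * a) * (c * d)
        ≈⟨ solve 4 (λ a b c d → con (+ 2) :* (b :* a) :* (c :* d) := c :* (con (+ 2) :* a :* b :* d))
        R.refl a b c d ⟩
      c * (fromℕ 2 * a * b * d)
        ≤⟨ *-monoʳ-≤ (inj₁ (H-pos i i)) (cross-term≤ j k (H-pos i k) (H-pos i j)) ⟩
      c * form H w w                        ≈⟨ R.*-congʳ (form-δ H i i) ⟨
      form H (δ i) (δ i) * form H w w
        ≤⟨ reverse-cauchy-schwarz H H-sym one (δ i) w (<-≤-trans (H-pos i i) (inj₂ (R.sym (form-δ H i i)))) ⟩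
      form H (δ i) w * form H (δ i) w       ≈⟨ R.*-cong iw iw ⟩
      (a * b + b * a) * (a * b + b * a)
        ≈⟨ solve 2
        (λ a b → (a :* b :+ b :* a) :* (a :* b :+ b :* a) := con (+ 2) :* (b :* a) :* (con (+ 2) :* (b :* a)))
        R.refl a b ⟩
      fromℕ 2 * (b * a) * (fromℕ 2 * (b * a)) ∎)
      where
      open ≤-Reasoning
      a = H i k
      b = H i j
      c = H i i
      d = H j k
      w = ⟨ a ·δ j + b ·δ k ⟩
      iw : form H (δ i) w ≈ a * b + b * a
      iw = R.trans (form-linearʳ H (δ i) a (δ j) b (δ k))
          (R.+-cong (R.*-congˡ (form-δ H i j)) (R.*-congˡ (form-δ H i k)))

    -- The weights of u and v are chosen so that three of the four terms of H(u, v) equal xyz. The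
    -- hypothesis ty ≤ xz bounds the fourth, y²t, by xyz as well, so H(u, v) ≤ 4xyz; the cross terms
    -- bound H(u, u) H(v, v) below by 4xy²z H_ij H_kl.
    four-term : ∀ i j k l → H i l * H j k ≤ H i k * H j l → H i j * H k l ≤ fromℕ 4 * (H i k * H j l)
    four-term i j k l il·jk≤ik·jl = *-cancelˡ-≤ 0<K (begin
      K * (H i j * H k l)
        ≈⟨ solve 5
            (λ x y z p q → con (+ 4) :* (y :* y :* (x :* z)) :* (p :* q) := (con (+ 2) :* y :* x :* p) :*
            (con (+ 2) :* z :* y :* q)) R.refl x y z (H i j) (H k l) ⟩
      (fromℕ 2 * y * x * H i j) * (fromℕ 2 * z * y * H k l)
        ≤⟨ *-mono-≤ (inj₁ (*-pos (*-pos (*-pos 0<2 y>0) x>0) (H-pos i j))) (inj₁ 0<vv)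
            (cross-term≤ i j y>0 x>0) (cross-term≤ k l z>0 y>0) ⟩
      form H u u * form H v v                 ≤⟨ reverse-cauchy-schwarz H H-sym one u v 0<uu ⟩
      form H u v * form H u v
        ≤⟨ *-mono-≤ (inj₁ 0<uv) (inj₁ (*-pos 0<4 (*-pos y>0 (*-pos x>0 z>0)))) uv≤ uv≤ ⟩
      fromℕ 4 * (y * (x * z)) * (fromℕ 4 * (y * (x * z)))
        ≈⟨ solve 3
            (λ x y z → con (+ 4) :* (y :* (x :* z)) :* (con (+ 4) :* (y :* (x :* z))) := con (+ 4) :*
            (y :* y :* (x :* z)) :* (con (+ 4) :* (x :* z))) R.refl x y z ⟩
      K * (fromℕ 4 * (x * z)) ∎)
      where
      open ≤-Reasoning
      x = H i k
      y = H j k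
      z = H j l
      t = H i l
      x>0 = H-pos i k
      y>0 = H-pos j k
      z>0 = H-pos j l
      K = fromℕ 4 * (y * y * (x * z))
      0<K = *-pos 0<4 (*-pos (*-pos y>0 y>0) (*-pos x>0 z>0))
      u = ⟨ y ·δ i + x ·δ j ⟩
      v = ⟨ z ·δ k + y ·δ l ⟩
      0<uu = <-≤-trans (*-pos (*-pos (*-pos 0<2 y>0) x>0) (H-pos i j)) (cross-term≤ i j y>0 x>0)
      0<vv = <-≤-trans (*-pos (*-pos (*-pos 0<2 z>0) y>0) (H-pos k l)) (cross-term≤ k l z>0 y>0)
      uv≈ : form H u v ≈ y * (z * x + y * t) + x * (z * y + y * z)
      uv≈ = R.trans (form-linearˡ H y (δ i) x (δ j) v) (R.+-cong
        (R.*-congˡ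
            (R.trans (form-linearʳ H (δ i) z (δ k) y (δ l))
            (R.+-cong (R.*-congˡ (form-δ H i k)) (R.*-congˡ (form-δ H i l)))))
        (R.*-congˡ
            (R.trans (form-linearʳ H (δ j) z (δ k) y (δ l))
            (R.+-cong (R.*-congˡ (form-δ H j k)) (R.*-congˡ (form-δ H j l))))))
      0<uv : 0# < form H u v
      0<uv = <-≤-trans (+-pos-nonneg (*-pos y>0 (+-pos-nonneg (*-pos z>0 x>0) (inj₁ (*-pos y>0 (H-pos i l)))))
                         (inj₁ (*-pos x>0 (+-pos-nonneg (*-pos z>0 y>0) (inj₁ (*-pos y>0 z>0))))))
                             (inj₂ (R.sym uv≈))
      uv≤ : form H u v ≤ fromℕ 4 * (y * (x * z))
      uv≤ = ≤.trans (inj₂ uv≈) (difference-nonneg⇒≤ (*-nonneg (inj₁ y>0) (≤⇒0≤- il·jk≤ik·jl))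
        (solve 4 (λ x y z t → con (+ 4) :* (y :* (x :* z)) :-
            (y :* (z :* x :+ y :* t) :+ x :* (z :* y :+ y :* z)) := y :* (x :* z :- t :* y)) R.refl x y z t))

  -- Hessians of coefficient families

  ⊕-comm : ∀ {n} (α β : Exponent n) → α ⊕ β ≡ β ⊕ α
  ⊕-comm = Vec.zipWith-comm ℕ.+-comm

  ⊕-assoc : ∀ {n} (α β γ : Exponent n) → α ⊕ β ⊕ γ ≡ α ⊕ (β ⊕ γ)
  ⊕-assoc = Vec.zipWith-assoc ℕ.+-assoc

  hessian-symmetric : ∀ {n} (c : Family n) β → Symmetric (hessian c β)
  hessian-symmetric c β i j = R.reflexive (≡.cong c (≡.trans (⊕-assoc β (e i) (e j))
    (≡.trans (≡.cong (β ⊕_) (⊕-comm (e i) (e j))) (≡.sym (⊕-assoc β (e j) (e i))))))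

  sum-⊕-e-e : ∀ {n} (β : Exponent n) i j → sum (β ⊕ e i ⊕ e j) ≡ sum β ℕ.+ 2
  sum-⊕-e-e β i j = ≡.trans (sum-⊕ (β ⊕ e i) (e j))
      (≡.trans (≡.cong₂ ℕ._+_ (≡.trans (sum-⊕ β (e i)) (≡.cong (sum β ℕ.+_) (sum-e i))) (sum-e j))
      (ℕ.+-assoc (sum β) 1 1))

  module _ {c : Family 4} (c∈L : L⁺ (Δ 4 4) c) where

    coefficient-pos : ∀ {α} → Simplex 4 4 α → 0# < c α
    coefficient-pos α∈ = Equivalence.from (c∈L .proj₂ α∈) α∈

    module Link (β : Exponent 4) (β∈ : Simplex 4 2 β) = PositiveOneEigenvalue (hessian c β)
        (hessian-symmetric c β)
      (λ i j → coefficient-pos (≡.trans (sum-⊕-e-e β i j) (≡.cong (ℕ._+ 2) β∈)))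
      (Lorentzian.hessian-sign (c∈L .proj₁) β∈)

  -- The bound 64

  -- In the product of the five inequalities the auxiliary coefficients cancel: m occurs twice on
  -- each side and a, b, d, g, h once. What remains is pqr against stu, with constant 2⁴ · 4.
  chain≤64 : ∀ {p q r s t u m a b d g h} →
    0# < p → 0# < q → 0# < r → 0# < m → 0# < a → 0# < b → 0# < d → 0# < g → 0# < h → 0# < s → 0# < t → 0# < u →
    q * m ≤ fromℕ 2 * (a * b) → p * b ≤ fromℕ 2 * (s * d) → d * g ≤ fromℕ 2 * (m * t) →
    a * h ≤ fromℕ 2 * (u * m) → m * r ≤ fromℕ 4 * (g * h) →
    p * q * r ≤ fromℕ 64 * (s * t * u)
  chain≤64 {p} {q} {r} {s} {t} {u} {m} {a} {b} {d} {g} {h} p>0 q>0 r>0 m>0 a>0 b>0 d>0 g>0 h>0 s>0 t>0 u>0 i₁ i₂ i₃ i₄ i₅ =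
    *-cancelˡ-≤ (*-pos m>0 (*-pos m>0 (*-pos a>0 (*-pos b>0 (*-pos d>0 (*-pos g>0 h>0)))))) (begin
      K * (p * q * r)
        ≈⟨ solve 10 (λ p q r m a b d g h o → m :* (m :* (a :* (b :* (d :* (g :* h))))) :* (p :* q :* r) :=
             (q :* m) :* ((p :* b) :* ((d :* g) :* ((a :* h) :* (m :* r))))) R.refl p q r m a b d g h 1# ⟩
      (q * m) * ((p * b) * ((d * g) * ((a * h) * (m * r))))
        ≤⟨ *-mono-≤ (inj₁ (*-pos q>0 m>0)) (inj₁ (*-pos 0<2sd (*-pos 0<2mt (*-pos 0<2um 0<4gh)))) i₁
           (*-mono-≤ (inj₁ (*-pos p>0 b>0)) (inj₁ (*-pos 0<2mt (*-pos 0<2um 0<4gh))) i₂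
           (*-mono-≤ (inj₁ (*-pos d>0 g>0)) (inj₁ (*-pos 0<2um 0<4gh)) i₃
           (*-mono-≤ (inj₁ (*-pos a>0 h>0)) (inj₁ 0<4gh) i₄ i₅))) ⟩
      (fromℕ 2 * (a * b)) *
          ((fromℕ 2 * (s * d)) * ((fromℕ 2 * (m * t)) * ((fromℕ 2 * (u * m)) * (fromℕ 4 * (g * h)))))
        ≈⟨ solve 9 (λ s t u m a b d g h → let two = con (+ 2) in
             (two :* (a :* b)) :*
                 ((two :* (s :* d)) :*
                 ((two :* (m :* t)) :* ((two :* (u :* m)) :* (con (+ 4) :* (g :* h))))) :=
             m :* (m :* (a :* (b :* (d :* (g :* h))))) :* (con (+ 64) :* (s :* t :* u)))
                 R.refl s t u m a b d g h ⟩
      K * (fromℕ 64 * (s * t * u)) ∎)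
    where
    open ≤-Reasoning
    K = m * (m * (a * (b * (d * (g * h)))))
    0<2 = fromℕ-pos {2} (ℕ.s≤s ℕ.z≤n)
    0<2sd = *-pos 0<2 (*-pos s>0 d>0)
    0<2mt = *-pos 0<2 (*-pos m>0 t>0)
    0<2um = *-pos 0<2 (*-pos u>0 m>0)
    0<4gh = *-pos (fromℕ-pos {4} (ℕ.s≤s ℕ.z≤n)) (*-pos g>0 h>0)

  numerator denominator : Family 4 → Carrier
  numerator c = c a1030 * c a3010 * c a0202
  denominator c = c a2020 * c a1012 * c a1210

  module _ {c : Family 4} (c∈L : L⁺ (Δ 4 4) c) where
    private
      i₁ i₂ i₃ i₄ : Fin 4
      i₁ = zero
      i₂ = suc zero
      i₃ = suc (suc zero)
      i₄ = suc (suc (suc zero))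
      module H1010 = Link c∈L (1 ∷ 0 ∷ 1 ∷ 0 ∷ []) ≡.refl
      module H1001 = Link c∈L (1 ∷ 0 ∷ 0 ∷ 1 ∷ []) ≡.refl
      module H0110 = Link c∈L (0 ∷ 1 ∷ 1 ∷ 0 ∷ []) ≡.refl
      module H1100 = Link c∈L (1 ∷ 1 ∷ 0 ∷ 0 ∷ []) ≡.refl
      module H0011 = Link c∈L (0 ∷ 0 ∷ 1 ∷ 1 ∷ []) ≡.refl
      module H0101 = Link c∈L (0 ∷ 1 ∷ 0 ∷ 1 ∷ []) ≡.refl
      pos : ∀ α {_ : True (sum α ℕ.≟ 4)} → 0# < c α
      pos α {α∈} = coefficient-pos c∈L {α} (toWitness α∈)
      c1111 = pos (1 ∷ 1 ∷ 1 ∷ 1 ∷ [])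
      c2110 = pos (2 ∷ 1 ∷ 1 ∷ 0 ∷ [])
      c2011 = pos (2 ∷ 0 ∷ 1 ∷ 1 ∷ [])

    -- Of c₁₂₀₁ c₀₁₁₂ and c₁₁₀₂ c₀₂₁₁, the larger one dominates c₁₁₁₁ c₀₂₀₂ up to a factor 4.
    numerator≤64*denominator : numerator c ≤ fromℕ 64 * denominator c
    numerator≤64*denominator with ≤.total (c (1 ∷ 2 ∷ 0 ∷ 1 ∷ []) * c (0 ∷ 1 ∷ 1 ∷ 2 ∷ []))
        (c (1 ∷ 1 ∷ 0 ∷ 2 ∷ []) * c (0 ∷ 2 ∷ 1 ∷ 1 ∷ []))
    ... | inj₁ p = chain≤64 (pos a1030) (pos a3010) (pos a0202) c1111 c2110 c2011
        (pos (1 ∷ 0 ∷ 2 ∷ 1 ∷ [])) (pos (1 ∷ 1 ∷ 0 ∷ 2 ∷ [])) (pos (0 ∷ 2 ∷ 1 ∷ 1 ∷ [])) (pos a2020)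
            (pos a1012) (pos a1210)
        (H1010.three-term i₁ i₂ i₄) (H1010.three-term i₃ i₁ i₄) (H1001.three-term i₃ i₂ i₄)
        (H0110.three-term i₁ i₂ i₄) (H0101.four-term i₁ i₃ i₄ i₂ p)
    -- The first chain with x₂ and x₄ exchanged. This exchange swaps c₁₀₁₂ and c₁₂₁₀, which the last
    -- rewriting swaps back.
    ... | inj₂ p = ≤.trans (chain≤64 (pos a1030) (pos a3010) (pos a0202) c1111 c2011 c2110
        (pos (1 ∷ 1 ∷ 2 ∷ 0 ∷ [])) (pos (1 ∷ 2 ∷ 0 ∷ 1 ∷ [])) (pos (0 ∷ 1 ∷ 1 ∷ 2 ∷ [])) (pos a2020)
            (pos a1210) (pos a1012)
        (H1010.three-term i₁ i₄ i₂) (H1010.three-term i₃ i₁ i₂) (H1100.three-term i₃ i₄ i₂)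
        (H0011.three-term i₁ i₄ i₂) (H0101.four-term i₁ i₃ i₂ i₄ p))
        (inj₂ (R.*-congˡ (solve 3 (λ s t u → s :* t :* u := s :* u :* t) R.refl _ _ _)))

    denominator-pos : 0# < denominator c
    denominator-pos = *-pos (*-pos (pos a2020) (pos a1012)) (pos a1210)

    R₄≤64 : R₄ c ≤ fromℕ 64
    R₄≤64 = *-cancelˡ-≤ denominator-pos (begin
      denominator c * (numerator c * denominator c ⁻¹)
        ≈⟨ solve 3 (λ d n i → d :* (n :* i) := d :* i :* n) R.refl (denominator c) (numerator c)
        (denominator c ⁻¹) ⟩
      denominator c * denominator c ⁻¹ * numerator c     ≈⟨ R.*-congʳ (⁻¹-inverseʳ (pos⇒≉0 denominator-pos)) ⟩
      1# * numerator c                                   ≈⟨ R.*-identityˡ _ ⟩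
      numerator c                                        ≤⟨ numerator≤64*denominator ⟩
      fromℕ 64 * denominator c                           ≈⟨ R.*-comm _ _ ⟩
      denominator c * fromℕ 64                           ∎)
      where open ≤-Reasoning

  -- Real powers

  ^-pos : ∀ {x} → 0# < x → ∀ n → 0# < x ^ n
  ^-pos 0<x zero    = 0<1
  ^-pos 0<x (suc n) = *-pos 0<x (^-pos 0<x n)

  ^-monoˡ-≤ : ∀ {x y} → 0# < x → x ≤ y → ∀ n → x ^ n ≤ y ^ n
  ^-monoˡ-≤ 0<x x≤y zero    = ≤.refl
  ^-monoˡ-≤ 0<x x≤y (suc n) = *-mono-≤ (inj₁ 0<x) (inj₁ (^-pos (<-≤-trans 0<x x≤y) n)) x≤y
      (^-monoˡ-≤ 0<x x≤y n)

  ^-monoˡ-< : ∀ {x y} → 0# < x → x < y → ∀ n → x ^ suc n < y ^ suc n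
  ^-monoˡ-< {x} {y} 0<x x<y n = ≤-<-trans (*-monoʳ-≤ (inj₁ 0<x) (^-monoˡ-≤ 0<x (inj₁ x<y) n))
    (≤-<-trans (inj₂ (R.*-comm x (y ^ n)))
        (<-≤-trans (*-monoʳ-< (^-pos (<.trans 0<x x<y) n) x<y) (inj₂ (R.*-comm (y ^ n) y))))

  ^-cancelˡ-≤ : ∀ {x y} → 0# < y → ∀ {n} → 1 ℕ.≤ n → x ^ n ≤ y ^ n → x ≤ y
  ^-cancelˡ-≤ 0<y (ℕ.s≤s {n = n} _) p = ≮⇒≥ λ y<x → ≤⇒≯ p (^-monoˡ-< 0<y y<x n)

  1≤⇒0< : ∀ {x} → 1# ≤ x → 0# < x
  1≤⇒0< = <-≤-trans 0<1

  1≤^ : ∀ {x} → 1# ≤ x → ∀ n → 1# ≤ x ^ n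
  1≤^ 1≤x zero    = ≤.refl
  1≤^ 1≤x (suc n) = ≤.trans (≤.trans 1≤x (inj₂ (R.sym (R.*-identityʳ _))))
      (*-monoʳ-≤ (inj₁ (1≤⇒0< 1≤x)) (1≤^ 1≤x n))

  ^-monoʳ-≤ : ∀ {x} → 1# ≤ x → ∀ {m n} → m ℕ.≤ n → x ^ m ≤ x ^ n
  ^-monoʳ-≤ {x} 1≤x {n = n} ℕ.z≤n = 1≤^ 1≤x n
  ^-monoʳ-≤ 1≤x (ℕ.s≤s p) = *-monoʳ-≤ (inj₁ (1≤⇒0< 1≤x)) (^-monoʳ-≤ 1≤x p)

  inverse-^ : ∀ {x y} → x * y ≈ 1# → ∀ n → x ^ n * y ^ n ≈ 1#
  inverse-^ {x} {y} p n = R.trans (R.sym (^-distrib-* x y n)) (R.trans (^-congˡ n p) (1^ n))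
    where
    1^ : ∀ n → 1# ^ n ≈ 1#
    1^ zero = R.refl
    1^ (suc n) = R.trans (R.*-identityˡ _) (1^ n)

  -- The set whose supremum is `pow≥1 x w`, named so that the supremum axioms can be applied to it.
  Below : Carrier → Carrier → Pred Carrier 0ℓ
  Below x w y = 0# < y × ∃[ a ] ∃[ b ] ∃[ q ]
    (1 ℕ.≤ q × fromℕ b ≤ fromℕ q * w + fromℕ a × (y ^ q) * (x ^ a) ≤ x ^ b)

  module _ {x} (1≤x : 1# ≤ x) where

    private 0<x = 1≤⇒0< 1≤x

    -- Here z is at least x^(m - n) with m - n ≥ w. Raising to the q-th power and clearing
    -- denominators reduces the claim to monotonicity of natural powers of x, with b + nq ≤ mq + a
    -- as the comparison of exponents.
    Below-bounded : ∀ {w m n z} → w + fromℕ n ≤ fromℕ m → 0# < z → x ^ m ≤ z * x ^ n → UpperBound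
        (Below x w) z
    Below-bounded {w} {m} {n} {z} w+n≤m 0<z xᵐ≤zxⁿ {y} (0<y , a , b , q , 1≤q , b≤qw+a , yᵠxᵃ≤xᵇ) =
      ^-cancelˡ-≤ 0<z 1≤q (*-cancelˡ-≤ (*-pos (^-pos 0<x a) (^-pos 0<x (n ℕ.* q))) (begin
        x ^ a * x ^ (n ℕ.* q) * y ^ q     ≈⟨ solve 3 (λ a b c → a :* b :* c := c :* a :* b) R.refl _ _ _ ⟩
        y ^ q * x ^ a * x ^ (n ℕ.* q)     ≤⟨ *-monoˡ-≤ (inj₁ (^-pos 0<x (n ℕ.* q))) yᵠxᵃ≤xᵇ ⟩
        x ^ b * x ^ (n ℕ.* q)             ≈⟨ ^-homo-* x b (n ℕ.* q) ⟨
        x ^ (b ℕ.+ n ℕ.* q)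
          ≤⟨ ^-monoʳ-≤ 1≤x (fromℕ-cancel-≤ {b ℕ.+ n ℕ.* q} {m ℕ.* q ℕ.+ a} exponents) ⟩
        x ^ (m ℕ.* q ℕ.+ a)               ≈⟨ ^-homo-* x (m ℕ.* q) a ⟩
        x ^ (m ℕ.* q) * x ^ a             ≈⟨ R.*-congʳ (^-assocʳ x m q) ⟨
        (x ^ m) ^ q * x ^ a
          ≤⟨ *-monoˡ-≤ (inj₁ (^-pos 0<x a)) (^-monoˡ-≤ (^-pos 0<x m) xᵐ≤zxⁿ q) ⟩
        (z * x ^ n) ^ q * x ^ a
          ≈⟨ R.*-congʳ (R.trans (^-distrib-* z (x ^ n) q) (R.*-congˡ (^-assocʳ x n q))) ⟩
        z ^ q * x ^ (n ℕ.* q) * x ^ a     ≈⟨ solve 3 (λ a b c → c :* b :* a := a :* b :* c) R.refl _ _ _ ⟩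
        x ^ a * x ^ (n ℕ.* q) * z ^ q     ∎))
      where
      open ≤-Reasoning
      exponents : fromℕ (b ℕ.+ n ℕ.* q) ≤ fromℕ (m ℕ.* q ℕ.+ a)
      exponents = begin
        fromℕ (b ℕ.+ n ℕ.* q)
          ≈⟨ R.trans (×-homo-+ 1# b (n ℕ.* q)) (R.+-congˡ (×1-homo-* n q)) ⟩
        fromℕ b + fromℕ n * fromℕ q                  ≤⟨ +-monoˡ-≤ _ b≤qw+a ⟩
        fromℕ q * w + fromℕ a + fromℕ n * fromℕ q
          ≈⟨ solve 4 (λ q w a n → q :* w :+ a :+ n :* q := (w :+ n) :* q :+ a) R.refl (fromℕ q) w (fromℕ a)
          (fromℕ n) ⟩
        (w + fromℕ n) * fromℕ q + fromℕ a            ≤⟨ +-monoˡ-≤ _ (*-monoˡ-≤ (fromℕ-nonneg q) w+n≤m) ⟩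
        fromℕ m * fromℕ q + fromℕ a
          ≈⟨ R.trans (×-homo-+ 1# (m ℕ.* q) a) (R.+-congʳ (×1-homo-* m q)) ⟨
        fromℕ (m ℕ.* q ℕ.+ a)                        ∎

    -- The supremum axiom needs some upper bound of the set. A natural C above w provides x^C, and
    -- it is an argument because such a C is available only up to double negation.
    Below≤pow≥1 : ∀ {w C y} → w ≤ fromℕ C → Below x w y → y ≤ pow≥1 x w
    Below≤pow≥1 {w} {C} {y} w≤C y∈ = sup-upper {P = Below x w} (y , y∈)
      (x ^ C , Below-bounded {w} {C} {0} (≤.trans (inj₂ (R.+-identityʳ w)) w≤C) (^-pos 0<x C)
          (inj₂ (R.sym (R.*-identityʳ _)))) y∈

    -- At the integer exponent m - n the upper bound z is itself a member of the set, with q = 1, so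
    -- the supremum is attained.
    pow≥1-exact : ∀ {w m n z} → w + fromℕ n ≈ fromℕ m → 0# < z → z * x ^ n ≈ x ^ m → pow≥1 x w ≈ z
    pow≥1-exact {w} {m} {n} {z} w+n≈m 0<z zxⁿ≈xᵐ = ≤.antisym
      (sup-least {P = Below x w} (z , z∈) bounded)
      (sup-upper {P = Below x w} (z , z∈) (z , bounded) z∈)
      where
      bounded : UpperBound (Below x w) z
      bounded = Below-bounded {w} {m} {n} (inj₂ w+n≈m) 0<z (inj₂ (R.sym zxⁿ≈xᵐ))
      z∈ : Below x w z
      z∈ = 0<z , n , m , 1 , ℕ.s≤s ℕ.z≤n ,
        inj₂ (R.trans (R.sym w+n≈m) (R.+-congʳ (solve 1 (λ w → w := con (+ 1) :* w) R.refl w))) ,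
        inj₂ (R.trans (R.*-congʳ (R.*-identityʳ z)) zxⁿ≈xᵐ)

    pow≡pow≥1 : ∀ w → pow x w ≡ pow≥1 x w
    pow≡pow≥1 w with compare x 1#
    ... | tri< x<1 _ _ = ⊥-elim (≤⇒≯ 1≤x x<1)
    ... | tri≈ _ _ _   = ≡.refl
    ... | tri> _ _ _   = ≡.refl

  infixr 8 _^ᶻ_
  _^ᶻ_ : Carrier → ℤ → Carrier
  x ^ᶻ (+ n)    = x ^ n
  x ^ᶻ -[1+ n ] = (x ⁻¹) ^ suc n

  pow-integer : ∀ {x w} i → 0# < x → w ≈ fromℤ i → pow x w ≈ x ^ᶻ i
  pow-integer {x} {w} i 0<x w≈i = by-size
    where
    xx⁻¹≈1 = ⁻¹-inverseʳ (pos⇒≉0 0<x)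
    x⁻¹x≈1 = R.trans (R.*-comm _ _) xx⁻¹≈1
    large : 1# ≤ x → ∀ i → w ≈ fromℤ i → pow≥1 x w ≈ x ^ᶻ i
    large 1≤x (+ m)    w≈i = pow≥1-exact 1≤x {m = m} {n = 0} (R.trans (R.+-identityʳ w) w≈i) (^-pos 0<x m)
        (R.*-identityʳ _)
    large 1≤x -[1+ n ] w≈i = pow≥1-exact 1≤x {m = 0} {n = suc n} (R.trans (R.+-congʳ w≈i) (R.-‿inverseˡ _))
      (^-pos (⁻¹-pos 0<x) (suc n)) (inverse-^ x⁻¹x≈1 (suc n))
    small : 1# ≤ x ⁻¹ → ∀ i → w ≈ fromℤ i → pow≥1 (x ⁻¹) w ⁻¹ ≈ x ^ᶻ i
    small 1≤x⁻¹ (+ m) w≈i = R.sym (⁻¹-unique (<-≤-trans (^-pos (⁻¹-pos 0<x) m) (inj₂ (R.sym exact)))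
        (R.trans (R.*-congʳ exact) (inverse-^ x⁻¹x≈1 m)))
      where
      exact : pow≥1 (x ⁻¹) w ≈ (x ⁻¹) ^ m
      exact = pow≥1-exact 1≤x⁻¹ {m = m} {n = 0} (R.trans (R.+-identityʳ w) w≈i) (^-pos (⁻¹-pos 0<x) m)
          (R.*-identityʳ _)
    small 1≤x⁻¹ -[1+ n ] w≈i = R.sym (⁻¹-unique (<-≤-trans (^-pos 0<x (suc n)) (inj₂ (R.sym exact)))
        (R.trans (R.*-congʳ exact) (inverse-^ xx⁻¹≈1 (suc n))))
      where
      exact : pow≥1 (x ⁻¹) w ≈ x ^ suc n
      exact = pow≥1-exact 1≤x⁻¹ {m = 0} {n = suc n} (R.trans (R.+-congʳ w≈i) (R.-‿inverseˡ _))
          (^-pos 0<x (suc n)) (inverse-^ xx⁻¹≈1 (suc n))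

    by-size : pow x w ≈ x ^ᶻ i
    by-size with compare x 1#
    ... | tri< x<1 _ _ = small (≮⇒≥ λ x⁻¹<1 → <.irrefl R.refl (≤-<-trans (inj₂ (R.sym xx⁻¹≈1)) (<.trans (*-monoʳ-< 0<x x⁻¹<1) (≤-<-trans (inj₂ (R.*-identityʳ x)) x<1)))) i w≈i
    ... | tri≈ _ x≈1 _ = large (inj₂ (R.sym x≈1)) i w≈i
    ... | tri> _ _ 1<x = large (inj₁ 1<x) i w≈i

  -- The ratio of `w₄` as a product of six factors

  elements-full : ∀ {n d} (S : Subset n d) → (∀ {α} → Simplex n d α → α ∈ S) → Subset.elements S ≡ simplex n d
  elements-full S full = List.filter-all (Subset._∈S? S) (All.tabulate λ α∈ → full (simplex-sound _ α∈))

  εᶻ : ∀ {n} → Exponent n → Exponent n → ℤ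
  εᶻ α α′ = if does (α ≟ α′) then + 1 else + 0

  -- An integer copy of `w₄`: it evaluates to numerals, which sums in an abstract field do not.
  w₄ᶻ : Exponent 4 → ℤ
  w₄ᶻ α = εᶻ a1030 α ℤ.+ εᶻ a3010 α ℤ.+ εᶻ a0202 α ℤ.- εᶻ a2020 α ℤ.- εᶻ a1012 α ℤ.- εᶻ a1210 α

  ε≈fromℤ : ∀ {n} (α α′ : Exponent n) → ε α α′ ≈ fromℤ (εᶻ α α′)
  ε≈fromℤ α α′ with does (α ≟ α′)
  ... | true  = R.sym (R.+-identityʳ 1#)
  ... | false = R.refl

  w₄≈fromℤ : ∀ α → w₄ α ≈ fromℤ (w₄ᶻ α)
  w₄≈fromℤ α = unwrap
      (minus (minus (minus (plus (plus (isε a1030) (isε a3010)) (isε a0202)) (isε a2020)) (isε a1012))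
      (isε a1210))
    where
    -- The wrapper lets i be inferred: it can be read off `Integer x i` but not off `fromℤ i`.
    record Integer (x : Carrier) (i : ℤ) : Set where
      no-eta-equality
      pattern
      constructor integer
      field unwrap : x ≈ fromℤ i
    open Integer
    isε : ∀ β → Integer (ε β α) (εᶻ β α)
    isε β = integer (ε≈fromℤ β α)
    plus : ∀ {x y i j} → Integer x i → Integer y j → Integer (x + y) (i ℤ.+ j)
    plus {i = i} {j} (integer p) (integer q) = integer (R.trans (R.+-cong p q) (R.sym (fromℤ-+ i j)))
    minus : ∀ {x y i j} → Integer x i → Integer y j → Integer (x - y) (i ℤ.- j)
    minus {j = j} p (integer q) = plus p (integer (R.trans (R.-‿cong q) (R.sym (fromℤ-neg j))))

  -- Skipping the zero exponents makes the product over all of Δ₄⁴ compute to its six relevant factors.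
  sparseProduct : ∀ {n} → (Exponent n → ℤ) → Family n → List (Exponent n) → Carrier
  sparseProduct z c []      = 1#
  sparseProduct z c (α ∷ L) with z α
  ... | + 0 = sparseProduct z c L
  ... | i   = c α ^ᶻ i * sparseProduct z c L

  product≈sparseProduct : ∀ {n} (w c : Family n) (z : Exponent n → ℤ) → (∀ α → w α ≈ fromℤ (z α)) →
    ∀ {L} → All (λ α → 0# < c α) L → foldr _*_ 1# (List.map (λ α → pow (c α) (w α)) L) ≈ sparseProduct z c L
  product≈sparseProduct w c z w≈z []                 = R.refl
  product≈sparseProduct w c z w≈z {α ∷ L} (0<c ∷ pos) with z α | w≈z α
  ... | + 0      | p = R.trans (R.*-cong (pow-integer (+ 0) 0<c p) (product≈sparseProduct w c z w≈z pos)) (R.*-identityˡ _)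
  ... | + suc n  | p = R.*-cong (pow-integer (+ suc n) 0<c p) (product≈sparseProduct w c z w≈z pos)
  ... | -[1+ n ] | p = R.*-cong (pow-integer -[1+ n ] 0<c p) (product≈sparseProduct w c z w≈z pos)

  ratio≤64 : ∀ {c} → L⁺ (Δ 4 4) c → ratio (Δ 4 4) w₄ c ≤ fromℕ 64
  ratio≤64 {c} c∈L = begin
    ratio (Δ 4 4) w₄ c
      ≡⟨ ≡.cong (λ L → foldr _*_ 1# (List.map (λ α → pow (c α) (w₄ α)) L)) (elements-full (Δ 4 4) λ p → p) ⟩
    foldr _*_ 1# (List.map (λ α → pow (c α) (w₄ α)) (simplex 4 4))
      ≈⟨ product≈sparseProduct w₄ c w₄ᶻ w₄≈fromℤ
          (All.tabulate λ α∈ → coefficient-pos c∈L (simplex-sound _ α∈)) ⟩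
    sparseProduct w₄ᶻ c (simplex 4 4)
      -- The factors come in the order in which `simplex 4 4` lists their indices: 0202, 1012, 1030,
      -- 1210, 2020, 3010. The power `p :^ 0` stands for the trailing `1#`.
      ≈⟨ solve 6 (λ p q r s t u → let o = p :^ 0 in
           r :^ 1 :* (t :^ 1 :* (p :^ 1 :* (u :^ 1 :* (s :^ 1 :* (q :^ 1 :* o))))) := p :* q :* r :*
               (s :* t :* u)) R.refl
           (c a1030) (c a3010) (c a0202) (c a2020 ⁻¹) (c a1012 ⁻¹) (c a1210 ⁻¹) ⟩
    numerator c * D⁻¹
      ≤⟨ *-monoˡ-≤
      (inj₁ (*-pos (*-pos (⁻¹-pos (pos a2020 ≡.refl)) (⁻¹-pos (pos a1012 ≡.refl)))
      (⁻¹-pos (pos a1210 ≡.refl)))) (numerator≤64*denominator c∈L) ⟩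
    fromℕ 64 * denominator c * D⁻¹
      ≈⟨ solve 7
      (λ k a b c x y z → k :* (a :* b :* c) :* (x :* y :* z) := k :*
      ((a :* x) :* (b :* y) :* (c :* z))) R.refl
           (fromℕ 64) (c a2020) (c a1012) (c a1210) (c a2020 ⁻¹) (c a1012 ⁻¹) (c a1210 ⁻¹) ⟩
    fromℕ 64 * ((c a2020 * c a2020 ⁻¹) * (c a1012 * c a1012 ⁻¹) * (c a1210 * c a1210 ⁻¹))
                                       ≈⟨ R.*-congˡ
                                           (R.*-cong (R.*-cong (inverse a2020 ≡.refl) (inverse a1012 ≡.refl))
                                           (inverse a1210 ≡.refl)) ⟩
    fromℕ 64 * (1# * 1# * 1#)
      ≈⟨ R.trans (R.*-congˡ (R.trans (R.*-identityʳ _) (R.*-identityʳ 1#))) (R.*-identityʳ _) ⟩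
    fromℕ 64                           ∎
    where
    open ≤-Reasoning
    D⁻¹ = c a2020 ⁻¹ * c a1012 ⁻¹ * c a1210 ⁻¹
    pos : ∀ α → Simplex 4 4 α → 0# < c α
    pos α = coefficient-pos c∈L {α}
    inverse : ∀ α → Simplex 4 4 α → c α * c α ⁻¹ ≈ 1#
    inverse α α∈ = ⁻¹-inverseʳ (pos⇒≉0 (pos α α∈))

  -- Growth of a ratio along a one-parameter family

  archimedean : ∀ x → ¬ ¬ (∃[ n ] x ≤ fromℕ n)
  archimedean x none = ≤⇒≯ (sup-least {P = Natural} inhabited below) (0<-⇒< (<-≤-trans 0<1
      (inj₂ (solve 2 (λ t e → e := t :- (t :- e)) R.refl S 1#))))
    where
    Natural : Pred Carrier 0ℓ
    Natural y = ∃[ n ] (y ≈ fromℕ n)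
    S = sup Natural
    inhabited : ∃ Natural
    inhabited = 0# , 0 , R.refl
    bounded : UpperBound Natural x
    bounded {y} (n , y≈n) = ≤.trans (inj₂ y≈n) (≮⇒≥ λ x<n → none (n , inj₁ x<n))
    below : UpperBound Natural (S - 1#)
    below {y} (n , y≈n) = difference-nonneg⇒≤
        (≤⇒0≤- (sup-upper {P = Natural} inhabited (x , bounded) {1# + y} (suc n , R.+-congˡ y≈n)))
      (solve 3 (λ s y o → s :- o :- y := s :- (o :+ y)) R.refl S y 1#)

  -- The integer b - a approximates x from below with error at most 1. Shifting by a makes the
  -- number nonnegative, so that the search can run down from a natural bound.
  floor : ∀ x → ¬ ¬ (∃[ a ] ∃[ b ] (fromℕ b ≤ x + fromℕ a × x + fromℕ a ≤ fromℕ (suc b)))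
  floor x none = archimedean (- x) λ (a , -x≤a) → archimedean (x + fromℕ a) λ (m , x+a≤m) →
    none (a , between m
        (≤.trans (≤⇒0≤- -x≤a) (inj₂ (solve 2 (λ x a → a :- (:- x) := x :+ a) R.refl x (fromℕ a)))) x+a≤m)
    where
    between : ∀ {y} m → 0# ≤ y → y ≤ fromℕ m → ∃[ b ] (fromℕ b ≤ y × y ≤ fromℕ (suc b))
    between zero    0≤y y≤0 = 0 , 0≤y , ≤.trans y≤0 (fromℕ-nonneg 1)
    between {y} (suc m) 0≤y y≤m+1 with ≤.total y (fromℕ m)
    ... | inj₁ y≤m = between m 0≤y y≤m
    ... | inj₂ m≤y = m , m≤y , y≤m+1

  ∑ₗ ∏ₗ : ∀ {A : Set} → List A → (A → Carrier) → Carrier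
  ∑ₗ L f = foldr _+_ 0# (List.map f L)
  ∏ₗ L f = foldr _*_ 1# (List.map f L)

  ∑ₗℕ : ∀ {A : Set} → List A → (A → ℕ) → ℕ
  ∑ₗℕ L f = foldr ℕ._+_ 0 (List.map f L)

  -- With x = (s^q)^a, the rational approximation (b - a′)/q of v from below gives s^(a b) ≤ x^v s^(a a′).
  pow-lower : ∀ {s v} (q a a′ b : ℕ) → 1# ≤ s → 1 ℕ.≤ q → fromℕ b ≤ fromℕ q * v + fromℕ a′ →
              s ^ (a ℕ.* b) ≤ pow ((s ^ q) ^ a) v * s ^ (a ℕ.* a′)
  pow-lower {s} {v} q a a′ b 1≤s 1≤q b≤qv+a′ = ≮⇒≥ λ reversed → archimedean v λ (C , v≤C) → ≤⇒≯
      (claim C v≤C) reversed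
    where
    0<s = 1≤⇒0< 1≤s
    x = (s ^ q) ^ a
    1≤x : 1# ≤ x
    1≤x = 1≤^ (1≤^ 1≤s q) a
    d = s ^ (a ℕ.* a′)
    0<d = ^-pos 0<s (a ℕ.* a′)
    y = s ^ (a ℕ.* b) * d ⁻¹
    yd≈ : y * d ≈ s ^ (a ℕ.* b)
    yd≈ = R.trans (solve 3 (λ y d i → y :* i :* d := d :* i :* y) R.refl (s ^ (a ℕ.* b)) d (d ⁻¹))
      (R.trans (R.*-congʳ (⁻¹-inverseʳ (pos⇒≉0 0<d))) (R.*-identityˡ _))
    x^≈ : ∀ k → x ^ k ≈ (s ^ (a ℕ.* k)) ^ q
    x^≈ k = begin
      ((s ^ q) ^ a) ^ k          ≈⟨ ^-assocʳ (s ^ q) a k ⟩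
      (s ^ q) ^ (a ℕ.* k)        ≈⟨ ^-assocʳ s q (a ℕ.* k) ⟩
      s ^ (q ℕ.* (a ℕ.* k))      ≡⟨ ≡.cong (s ^_) (ℕ.*-comm q (a ℕ.* k)) ⟩
      s ^ (a ℕ.* k ℕ.* q)        ≈⟨ ^-assocʳ s (a ℕ.* k) q ⟨
      (s ^ (a ℕ.* k)) ^ q        ∎
      where open ≈-Reasoning
    y∈ : Below x v y
    y∈ = *-pos (^-pos 0<s (a ℕ.* b)) (⁻¹-pos 0<d) , a′ , b , q , 1≤q , b≤qv+a′ , inj₂ (begin
      y ^ q * x ^ a′             ≈⟨ R.*-congˡ (x^≈ a′) ⟩
      y ^ q * d ^ q              ≈⟨ ^-distrib-* y d q ⟨
      (y * d) ^ q                ≈⟨ ^-congˡ q yd≈ ⟩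
      (s ^ (a ℕ.* b)) ^ q        ≈⟨ x^≈ b ⟨
      x ^ b                      ∎)
      where open ≈-Reasoning
    claim : ∀ C → v ≤ fromℕ C → s ^ (a ℕ.* b) ≤ pow x v * d
    claim C v≤C = begin
      s ^ (a ℕ.* b)              ≈⟨ yd≈ ⟨
      y * d                      ≤⟨ *-monoˡ-≤ (inj₁ 0<d) (Below≤pow≥1 1≤x {C = C} v≤C y∈) ⟩
      pow≥1 x v * d              ≡⟨ ≡.cong (_* d) (pow≡pow≥1 1≤x v) ⟨
      pow x v * d                ∎
      where open ≤-Reasoning

  -- At t = s^q the product is at least s^(P - P′), where P - P′ falls short of q times the pairing
  -- by at most the sum of the a γ. Each q v γ is rounded down with error at most 1 and then
  -- multiplied by a γ, so the total error does not depend on q.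
  product-lower : ∀ {A : Set} (a : A → ℕ) (v : A → Carrier) q → 1 ℕ.≤ q → ∀ L →
    ¬ ¬ (∃[ P ] ∃[ P′ ] (fromℕ q * ∑ₗ L (λ γ → v γ * fromℕ (a γ)) + fromℕ P′ ≤ fromℕ P + fromℕ (∑ₗℕ L a) ×
      (∀ s → 1# ≤ s → s ^ P ≤ ∏ₗ L (λ γ → pow ((s ^ q) ^ a γ) (v γ)) * s ^ P′)))
  product-lower a v q 1≤q [] none = none (0 , 0 ,
    inj₂ (solve 1 (λ q → q :* con (+ 0) :+ con (+ 0) := con (+ 0) :+ con (+ 0)) R.refl (fromℕ q)) ,
    λ s 1≤s → inj₂ (R.sym (R.*-identityˡ 1#)))
  product-lower a v q 1≤q (γ ∷ L) none = product-lower a v q 1≤q L λ (P , P′ , exponents , powers) →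
    floor (fromℕ q * v γ) λ (a′ , b , b≤ , ≤b+1) → none (k ℕ.* b ℕ.+ P , k ℕ.* a′ ℕ.+ P′ , (begin
      fromℕ q * (v γ * fromℕ k + Σ) + fromℕ (k ℕ.* a′ ℕ.+ P′)
        ≈⟨ R.+-congˡ (hom k a′ P′) ⟩
      fromℕ q * (v γ * fromℕ k + Σ) + (fromℕ k * fromℕ a′ + fromℕ P′)
        ≈⟨ solve 6
            (λ q v k S a P → q :* (v :* k :+ S) :+ (k :* a :+ P) := k :* (q :* v :+ a) :+ (q :* S :+ P))
            R.refl (fromℕ q) (v γ) (fromℕ k) Σ (fromℕ a′) (fromℕ P′) ⟩
      fromℕ k * (fromℕ q * v γ + fromℕ a′) + (fromℕ q * Σ + fromℕ P′)
        ≤⟨ +-mono-≤ (*-monoʳ-≤ (fromℕ-nonneg k) ≤b+1) exponents ⟩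
      fromℕ k * (1# + fromℕ b) + (fromℕ P + fromℕ (∑ₗℕ L a))
        ≈⟨ R.+-congʳ (R.trans (R.distribˡ _ _ _) (R.+-congʳ (R.*-identityʳ _))) ⟩
      fromℕ k + fromℕ k * fromℕ b + (fromℕ P + fromℕ (∑ₗℕ L a))
        ≈⟨ solve 5 (λ k b P A kb → k :+ kb :+ (P :+ A) := kb :+ P :+ (k :+ A)) R.refl (fromℕ k) (fromℕ b)
            (fromℕ P) (fromℕ (∑ₗℕ L a)) (fromℕ k * fromℕ b) ⟩
      fromℕ k * fromℕ b + fromℕ P + (fromℕ k + fromℕ (∑ₗℕ L a))
        ≈⟨ R.+-cong (hom k b P) (×-homo-+ 1# k (∑ₗℕ L a)) ⟨
      fromℕ (k ℕ.* b ℕ.+ P) + fromℕ (∑ₗℕ (γ ∷ L) a) ∎) , λ s 1≤s → let 0<s = 1≤⇒0< 1≤s; Π = ∏ₗ L (λ γ → pow ((s ^ q) ^ a γ) (v γ)); p = pow ((s ^ q) ^ k) (v γ) in begin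
      s ^ (k ℕ.* b ℕ.+ P)                          ≈⟨ ^-homo-* s (k ℕ.* b) P ⟩
      s ^ (k ℕ.* b) * s ^ P
        ≤⟨ *-mono-≤ (inj₁ (^-pos 0<s (k ℕ.* b))) (≤.trans (inj₁ (^-pos 0<s P)) (powers s 1≤s))
        (pow-lower q k a′ b 1≤s 1≤q b≤) (powers s 1≤s) ⟩
      (p * s ^ (k ℕ.* a′)) * (Π * s ^ P′)
        ≈⟨ solve 4 (λ p x Π y → p :* x :* (Π :* y) := p :* Π :* (x :* y)) R.refl p (s ^ (k ℕ.* a′)) Π
        (s ^ P′) ⟩
      p * Π * (s ^ (k ℕ.* a′) * s ^ P′)            ≈⟨ R.*-congˡ (^-homo-* s (k ℕ.* a′) P′) ⟨
      p * Π * s ^ (k ℕ.* a′ ℕ.+ P′)                ∎)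
    where
    open ≤-Reasoning
    k = a γ
    Σ = ∑ₗ L (λ γ → v γ * fromℕ (a γ))
    hom : ∀ k a P → fromℕ (k ℕ.* a ℕ.+ P) ≈ fromℕ k * fromℕ a + fromℕ P
    hom k a P = R.trans (×-homo-+ 1# (k ℕ.* a) P) (R.+-congʳ (×1-homo-* k a))

  -- If the pairing σ were positive, a q with qσ above the fixed rounding error A would give P′ < P.
  -- The ratio at t = s^q is then at least s for every s ≥ 1, and a natural s above M contradicts
  -- the bound.
  BR-nonpositive : ∀ {n d} {S : Subset n d} (a : Exponent n → ℕ) → (∀ t → 1# ≤ t → L⁺ S (λ α → t ^ a α)) →
    ∀ {v} → BR S v → ∑ₗ (Subset.elements S) (λ α → v α * fromℕ (a α)) ≤ 0#
  BR-nonpositive {S = S} a family {v} (M , bound) = ≮⇒≥ λ 0<σ →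
    archimedean (A * σ ⁻¹) λ (q , Aσ⁻¹≤q) → archimedean M λ (k , M≤k) →
    product-lower a v (suc q) (ℕ.s≤s ℕ.z≤n) L λ (P , P′ , exponents , powers) →
    let
      A<qσ : A < fromℕ (suc q) * σ
      A<qσ = begin-strict
        A                       ≈⟨ R.*-identityʳ A ⟨
        A * 1#                  ≈⟨ R.*-congˡ (⁻¹-inverseʳ (pos⇒≉0 0<σ)) ⟨
        A * (σ * σ ⁻¹)          ≈⟨ solve 3 (λ A s i → A :* (s :* i) := s :* (A :* i)) R.refl A σ (σ ⁻¹) ⟩
        σ * (A * σ ⁻¹)          <⟨ *-monoʳ-< 0<σ (≤-<-trans Aσ⁻¹≤q (fromℕ-mono-< (ℕ.n<1+n q))) ⟩
        σ * fromℕ (suc q)       ≈⟨ R.*-comm _ _ ⟩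
        fromℕ (suc q) * σ       ∎
      P′<P : P′ ℕ.< P
      P′<P = fromℕ-cancel-< (0<-⇒< (<-≤-trans (+-pos-nonneg (<⇒0<- A<qσ) (≤⇒0≤- exponents))
        (inj₂ (solve 4 (λ A x P P′ → x :- A :+ (P :+ A :- (x :+ P′)) := P :- P′) R.refl A (fromℕ (suc q) * σ)
            (fromℕ P) (fromℕ P′)))))
      s = fromℕ (suc k)
      1≤s : 1# ≤ s
      1≤s = ≤.trans (inj₂ (R.sym (R.+-identityʳ 1#))) (fromℕ-mono-≤ {1} {suc k} (ℕ.s≤s ℕ.z≤n))
      0<s = 1≤⇒0< 1≤s
    in ≤⇒≯ (begin
      s ^ suc P′                ≤⟨ ^-monoʳ-≤ 1≤s P′<P ⟩
      s ^ P                     ≤⟨ powers s 1≤s ⟩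
      ∏ₗ L (λ γ → pow ((s ^ suc q) ^ a γ) (v γ)) * s ^ P′
        ≤⟨ *-monoˡ-≤ (inj₁ (^-pos 0<s P′)) (bound (family (s ^ suc q) (1≤^ 1≤s (suc q)))) ⟩
      M * s ^ P′                ≈⟨ R.*-comm _ _ ⟩
      s ^ P′ * M                ∎)
      (<-≤-trans (*-monoʳ-< (^-pos 0<s P′) (≤-<-trans M≤k (fromℕ-mono-< (ℕ.n<1+n k)))) (inj₂ (R.*-comm _ _)))
    where
    open ≤-Reasoning
    L = Subset.elements S
    σ = ∑ₗ L (λ α → v α * fromℕ (a α))
    A = fromℕ (∑ₗℕ L a)

  -- Split quadrics

  -- For eigenvectors u, v with positive eigenvalues, w = (p·v) u - (p·u) v is orthogonal to p, so
  -- H(w, w) ≤ 0. Distinct eigenvalues would make u and v orthogonal for H and H(w, w) positive. For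
  -- equal ones H w = λ′ w, hence w = 0, and this is the linear dependence: p·u ≠ 0, as otherwise
  -- H(u, u) ≤ 0.
  rank-one-bound⇒one-positive : ∀ {n} (H : Matrix n) → Symmetric H → ∀ {κ p} →
    (∀ x → form H x x ≤ κ * (dot p x * dot p x)) → AtMostOnePositiveEigenvalue H
  rank-one-bound⇒one-positive {n} H H-sym {κ} {p} bound = record
    { unique = λ {λ′} {μ} 0<λ 0<μ (u , u∈) (v , v∈) → ≈-stable λ λ≉μ → independent 0<λ 0<μ u v u∈ v∈
        (eigenvectors-orthogonal u v λ≉μ u∈ v∈)
    ; simple = λ {λ′} 0<λ {u} {v} u∈ v∈ → dot p v , - dot p u ,
        (λ (_ , b≈0) → p·u≉0 0<λ u u∈
            (R.trans (R.sym (RG.⁻¹-involutive _)) (R.trans (R.-‿cong b≈0) RG.ε⁻¹≈ε))) ,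
        dot≤0⇒≈0 {v = w u v}
            (*-cancelˡ-≤ 0<λ (≤.trans (inj₂ (R.sym (form-eigenvector λ′ (w u v) (combination u v u∈ v∈))))
          (≤.trans (form-w≤0 u v) (inj₂ (R.sym (R.zeroʳ λ′))))))
    }
    where
    open ≈-Reasoning
    w : (u v : Vector Carrier n) → Vector Carrier n
    w u v i = dot p v * u i + - dot p u * v i

    form-eigenvector : ∀ λ′ u → (∀ i → mv H u i ≈ λ′ * u i) → form H u u ≈ λ′ * dot u u
    form-eigenvector λ′ u Hu≈ = R.trans (dot-congʳ u Hu≈) (dot-*ʳ u λ′ u)

    form-w≤0 : ∀ u v → form H (w u v) (w u v) ≤ 0#
    form-w≤0 u v = ≤.trans (bound (w u v)) (inj₂ (begin
      κ * (dot p (w u v) * dot p (w u v))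
        ≈⟨ R.*-congˡ (R.*-congʳ (dot-linearʳ p (dot p v) u (- dot p u) v)) ⟩
      κ * ((dot p v * dot p u + - dot p u * dot p v) * dot p (w u v))
        ≈⟨ solve 4 (λ k x y d → k :* ((x :* y :+ (:- y) :* x) :* d) := con (+ 0)) R.refl κ (dot p v) (dot p u)
            (dot p (w u v)) ⟩
      0#                                     ∎))

    p·u≉0 : ∀ {λ′} → 0# < λ′ → ∀ u → Eigenvector H λ′ u → ¬ (dot p u ≈ 0#)
    p·u≉0 {λ′} 0<λ u (u≉0 , Hu≈λu) p·u≈0 = ≤⇒≯
        (≤.trans (bound u) (inj₂ (R.trans (R.*-congˡ (R.trans (R.*-congʳ p·u≈0) (R.zeroˡ _))) (R.zeroʳ κ))))
      (<-≤-trans (*-pos 0<λ (dot-pos u≉0)) (inj₂ (R.sym (form-eigenvector λ′ u Hu≈λu))))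

    combination : ∀ {λ′} u v → Eigenvector H λ′ u → Eigenvector H λ′ v → ∀ i → mv H (w u v) i ≈ λ′ * w u v i
    combination {λ′} u v (_ , Hu≈) (_ , Hv≈) i = begin
      mv H (w u v) i                               ≈⟨ dot-linearʳ (H i) (dot p v) u (- dot p u) v ⟩
      dot p v * mv H u i + - dot p u * mv H v i    ≈⟨ R.+-cong (R.*-congˡ (Hu≈ i)) (R.*-congˡ (Hv≈ i)) ⟩
      dot p v * (λ′ * u i) + - dot p u * (λ′ * v i)
        ≈⟨ solve 5 (λ a b l u v → a :* (l :* u) :+ b :* (l :* v) := l :* (a :* u :+ b :* v)) R.refl (dot p v)
            (- dot p u) λ′ (u i) (v i) ⟩
      λ′ * w u v i                                 ∎

    eigenvectors-orthogonal : ∀ {λ′ μ} u v → ¬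
        (λ′ ≈ μ) → Eigenvector H λ′ u → Eigenvector H μ v → form H u v ≈ 0#
    eigenvectors-orthogonal {λ′} {μ} u v λ≉μ (_ , Hu≈) (_ , Hv≈) = R.trans Huv≈μ
        (R.trans (R.*-congˡ u·v≈0) (R.zeroʳ μ))
      where
      Huv≈μ : form H u v ≈ μ * dot u v
      Huv≈μ = R.trans (dot-congʳ u Hv≈) (dot-*ʳ u μ v)
      Huv≈λ : form H u v ≈ λ′ * dot u v
      Huv≈λ = R.trans (form-symmetric H H-sym u v)
          (R.trans (dot-congʳ v Hu≈) (R.trans (dot-*ʳ v λ′ u) (R.*-congˡ (dot-comm v u))))
      u·v≈0 : dot u v ≈ 0#
      u·v≈0 = *-integral (λ p → λ≉μ (RG.x∙y⁻¹≈ε⇒x≈y λ′ μ p)) (R.trans (RP.[y-z]x≈yx-zx (dot u v) λ′ μ)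
        (R.trans (R.+-cong (R.sym Huv≈λ) (R.-‿cong (R.sym Huv≈μ))) (R.-‿inverseʳ _)))

    independent : ∀ {λ′ μ} → 0# < λ′ → 0# < μ → ∀ u v → Eigenvector H λ′ u → Eigenvector H μ v → ¬
        (form H u v ≈ 0#)
    independent {λ′} {μ} 0<λ 0<μ u v u∈ v∈ Huv≈0 = ≤⇒≯ (form-w≤0 u v) (<-≤-trans
      (+-pos-nonneg (*-pos (sq-pos (p·u≉0 0<λ u u∈)) (*-pos 0<μ (dot-pos (v∈ .proj₁))))
                    (*-nonneg (sq-nonneg (dot p v)) (*-nonneg (inj₁ 0<λ) (dot-nonneg u))))
      (inj₂ (begin
        b * b * (μ * dot v v) + a * a * (λ′ * dot u u)
          ≈⟨ R.+-cong (R.*-congˡ (R.sym (form-eigenvector μ v (v∈ .proj₂))))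
              (R.*-congˡ (R.sym (form-eigenvector λ′ u (u∈ .proj₂)))) ⟩
        b * b * form H v v + a * a * form H u u
          ≈⟨ solve 4
              (λ a b x z → b :* b :* z :+ a :* a :* x := a :* a :* x :+ con (+ 2) :* a :* (:- b) :* con
              (+ 0) :+ (:- b) :* (:- b) :* z) R.refl a b (form H u u) (form H v v) ⟩
        a * a * form H u u + fromℕ 2 * a * - b * 0# + - b * - b * form H v v
          ≈⟨ R.+-congʳ (R.+-congˡ (R.*-congˡ Huv≈0)) ⟨
        a * a * form H u u + fromℕ 2 * a * - b * form H u v + - b * - b * form H v v
          ≈⟨ form-square H H-sym a u (- b) v ⟨
        form H (w u v) (w u v) ∎)))
      where
      a = dot p v
      b = dot p u

  -- Exponent arithmetic and M-convexity of the full simplex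

  all-zero : ∀ {n} (α : Exponent n) → sum α ≡ 0 → α ≡ replicate n 0
  all-zero []         _  = ≡.refl
  all-zero (zero ∷ α) eq = ≡.cong (0 ∷_) (all-zero α eq)

  0⊕ : ∀ {n} (α : Exponent n) → replicate n 0 ⊕ α ≡ α
  0⊕ []      = ≡.refl
  0⊕ (k ∷ α) = ≡.cong (k ∷_) (0⊕ α)

  split-e : ∀ {n d} (α : Exponent n) → sum α ≡ suc d → ∃[ i ] ∃[ β ] (α ≡ e i ⊕ β × sum β ≡ d)
  split-e (suc k ∷ α) eq = zero , k ∷ α , ≡.cong (suc k ∷_) (≡.sym (0⊕ α)) , ℕ.suc-injective eq
  split-e (zero ∷ α)  eq with split-e α eq
  ... | i , β , ≡.refl , eq′ = suc i , 0 ∷ β , ≡.refl , eq′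

  degree-two : ∀ {n} (α : Exponent n) → sum α ≡ 2 → ∃[ i ] ∃[ j ] (α ≡ e i ⊕ e j)
  degree-two α eq with split-e α eq
  ... | i , β , ≡.refl , eq′ with split-e β eq′
  ...   | j , γ , ≡.refl , eq″ with all-zero γ eq″
  ...     | ≡.refl = i , j , ≡.cong (e i ⊕_) (≡.trans (⊕-comm (e j) _) (0⊕ (e j)))

  sum-⊖-e : ∀ {n d} (α : Exponent n) i → 0 ℕ.< lookup α i → sum α ≡ suc d → sum (α ⊖ e i) ≡ d
  sum-⊖-e (suc k ∷ α) zero    _ eq = ≡.trans (≡.cong (k ℕ.+_) (≡.cong sum (⊖0 α))) (ℕ.suc-injective eq)
    where
    ⊖0 : ∀ {n} (α : Exponent n) → α ⊖ replicate n 0 ≡ α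
    ⊖0 []      = ≡.refl
    ⊖0 (k ∷ α) = ≡.cong (k ∷_) (⊖0 α)
  sum-⊖-e {d = d} (k ∷ α) (suc i) p eq = ≡.trans
      (≡.cong (k ℕ.+_) (sum-⊖-e {d = sum α ℕ.∸ 1} α i p (positive α i p)))
      (ℕ.suc-injective
          (≡.trans (≡.trans (≡.sym (ℕ.+-suc k _)) (≡.cong (k ℕ.+_) (≡.sym (positive α i p)))) eq))
    where
    positive : ∀ {n} (α : Exponent n) i → 0 ℕ.< lookup α i → sum α ≡ suc (sum α ℕ.∸ 1)
    positive (suc k ∷ α) zero    _ = ≡.refl
    positive (zero  ∷ α) (suc i) p = positive α i p
    positive (suc k ∷ α) (suc i) p = ≡.refl

  sum-exchange : ∀ {n d} (α : Exponent n) i j → 0 ℕ.< lookup α i → sum α ≡ d → sum (α ⊖ e i ⊕ e j) ≡ d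
  sum-exchange {d = zero} α i j p eq with all-zero α eq
  ... | ≡.refl = ⊥-elim (ℕ.n≮0 (≡.subst (0 ℕ.<_) (Vec.lookup-replicate i 0) p))
  sum-exchange {d = suc d} α i j p eq = ≡.trans (sum-⊕ (α ⊖ e i) (e j))
    (≡.trans (≡.cong₂ ℕ._+_ (sum-⊖-e α i p eq) (sum-e j)) (ℕ.+-comm d 1))

  sum-mono-≤ : ∀ {n} (α β : Exponent n) → (∀ j → lookup α j ℕ.≤ lookup β j) → sum α ℕ.≤ sum β
  sum-mono-≤ []      []      p = ℕ.z≤n
  sum-mono-≤ (k ∷ α) (l ∷ β) p = ℕ.+-mono-≤ (p zero) (sum-mono-≤ α β λ j → p (suc j))

  sum-mono-< : ∀ {n} (α β : Exponent n) →
      (∀ j → lookup α j ℕ.≤ lookup β j) → ∀ i → lookup α i ℕ.< lookup β i → sum α ℕ.< sum β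
  sum-mono-< (k ∷ α) (l ∷ β) p zero    q = ℕ.+-mono-<-≤ q (sum-mono-≤ α β λ j → p (suc j))
  sum-mono-< (k ∷ α) (l ∷ β) p (suc i) q = ℕ.+-mono-≤-< (p zero) (sum-mono-< α β (λ j → p (suc j)) i q)

  simplex-mconvex : ∀ {n d} {S : Pred (Exponent n) 0ℓ} → (∀ {α} → S α → Simplex n d α) →
      (∀ {α} → Simplex n d α → S α) → ∃ S → MConvex n d S
  simplex-mconvex {n} {d} {S} S⊆Δ Δ⊆S inhabited = record
    { ⊆simplex = S⊆Δ
    ; nonempty = inhabited
    ; exchange = λ {α} {β} α∈ β∈ i βᵢ<αᵢ → exchange α β (S⊆Δ α∈) (S⊆Δ β∈) i βᵢ<αᵢ
    }
    where
    exchange : ∀ α β → Simplex n d α → Simplex n d β → ∀ i → lookup β i ℕ.< lookup α i →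
               ∃[ j ] (lookup α j ℕ.< lookup β j × S (α ⊖ e i ⊕ e j) × S (β ⊖ e j ⊕ e i))
    exchange α β α∈ β∈ i βᵢ<αᵢ with any? (λ j → lookup α j ℕ.<? lookup β j)
    ... | yes (j , αⱼ<βⱼ) = j , αⱼ<βⱼ , Δ⊆S (sum-exchange α i j (ℕ.≤-<-trans ℕ.z≤n βᵢ<αᵢ) α∈) ,
                                        Δ⊆S (sum-exchange β j i (ℕ.≤-<-trans ℕ.z≤n αⱼ<βⱼ) β∈)
    -- With no such j, β lies below α everywhere and strictly below at i, although both have the
    -- same degree.
    ... | no none = ⊥-elim (ℕ.<-irrefl (≡.trans β∈ (≡.sym α∈)) (sum-mono-< β α (λ j → ℕ.≮⇒≥ λ q → none (j , q)) i βᵢ<αᵢ))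

  infixl 7 _·_
  _·_ : ∀ {n} → Vec ℕ n → Exponent n → ℕ
  []      · []      = 0
  (k ∷ u) · (l ∷ α) = k ℕ.* l ℕ.+ u · α

  ·-⊕ : ∀ {n} (u : Vec ℕ n) α β → u · (α ⊕ β) ≡ u · α ℕ.+ u · β
  ·-⊕ []      []      []      = ≡.refl
  ·-⊕ (k ∷ u) (l ∷ α) (m ∷ β) = ≡.trans (≡.cong₂ ℕ._+_ (ℕ.*-distribˡ-+ k l m) (·-⊕ u α β))
    (interchange ℕ.+-commutativeSemigroup (k ℕ.* l) (k ℕ.* m) (u · α) (u · β))

  ·-e : ∀ {n} (u : Vec ℕ n) i → u · e i ≡ lookup u i
  ·-e (k ∷ u) zero    = ≡.trans (≡.cong₂ ℕ._+_ (ℕ.*-identityʳ k) (·-0 u)) (ℕ.+-identityʳ k)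
    where
    ·-0 : ∀ {n} (u : Vec ℕ n) → u · replicate n 0 ≡ 0
    ·-0 []      = ≡.refl
    ·-0 (k ∷ u) = ≡.trans (≡.cong₂ ℕ._+_ (ℕ.*-zeroʳ k) (·-0 u)) ≡.refl
  ·-e (k ∷ u) (suc i) = ≡.trans (≡.cong (ℕ._+ u · e i) (ℕ.*-zeroʳ k)) (·-e u i)

  ·-e⊕e : ∀ {n} (u : Vec ℕ n) i j → u · (e i ⊕ e j) ≡ lookup u i ℕ.+ lookup u j
  ·-e⊕e u i j = ≡.trans (·-⊕ u (e i) (e j)) (≡.cong₂ ℕ._+_ (·-e u i) (·-e u j))

  -- Stands for the quadric t^h (p·x)² − (t^h − 1) (q·x)², where p_i = t^(u_i) and q is the restriction of p to A.
  record Weight (n : ℕ) : Set where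
    constructor weight
    field
      u : Vec ℕ n
      h : ℕ
      A : Vec Bool n

  indicator : Bool → ℕ
  indicator b = if b then 1 else 0

  -- For γ of degree two the inner product with the indicator is 2 exactly when both variables of γ
  -- lie in A. There the two squares of the quadric nearly cancel and the factor t^h is lost.
  weigh : ∀ {n} → Weight n → Exponent n → ℕ
  weigh (weight u h A) γ = u · γ ℕ.+ (if does (Vec.map indicator A · γ ℕ.≟ 2) then 0 else h)

  weigh-e⊕e : ∀ {n} (u : Vec ℕ n) h A i j → weigh (weight u h A) (e i ⊕ e j) ≡
    lookup u i ℕ.+ lookup u j ℕ.+ (if lookup A i ∧ lookup A j then 0 else h)
  weigh-e⊕e u h A i j = ≡.cong₂ ℕ._+_ (·-e⊕e u i j) (≡.trans
    (≡.cong (λ k → if does (k ℕ.≟ 2) then 0 else h) (≡.trans (·-e⊕e (Vec.map indicator A) i j)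
      (≡.cong₂ ℕ._+_ (Vec.lookup-map i indicator A) (Vec.lookup-map j indicator A))))
    (both (lookup A i) (lookup A j)))
    where
    both : ∀ a b → (if does (indicator a ℕ.+ indicator b ℕ.≟ 2) then 0 else h) ≡ (if a ∧ b then 0 else h)
    both true  true  = ≡.refl
    both true  false = ≡.refl
    both false true  = ≡.refl
    both false false = ≡.refl

  -- The subtracted square has a nonnegative factor, so dropping it leaves the rank-one bound κ
  -- (p·x)².
  rank-two⇒one-positive : ∀ {n} (H : Matrix n) (p q : Vector Carrier n) {κ μ} → 0# ≤ μ →
    (∀ i j → H i j ≈ κ * p i * p j - μ * q i * q j) → AtMostOnePositiveEigenvalue H
  rank-two⇒one-positive {n} H p q {κ} {μ} 0≤μ H≈ = rank-one-bound⇒one-positive H symmetric {κ} {p} λ x →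
    ≤.trans (inj₂ (form-H x)) (difference-nonneg⇒≤ (*-nonneg 0≤μ (sq-nonneg (dot q x)))
      (solve 2 (λ a b → a :- (a :- b) := b) R.refl (κ * (dot p x * dot p x)) (μ * (dot q x * dot q x))))
    where
    open ≈-Reasoning
    symmetric : Symmetric H
    symmetric i j = begin
      H i j                              ≈⟨ H≈ i j ⟩
      κ * p i * p j - μ * q i * q j
        ≈⟨ solve 6 (λ k m a b x y → k :* a :* b :- m :* x :* y := k :* b :* a :- m :* y :* x) R.refl κ μ (p i)
        (p j) (q i) (q j) ⟩
      κ * p j * p i - μ * q j * q i      ≈⟨ H≈ j i ⟨
      H j i                              ∎
    Z : Matrix n
    Z _ _ = 0#
    -- Deflating the zero matrix by -κ creates the square κ (p·x)², so `form-deflate` computes the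
    -- whole form.
    D = deflate (deflate Z (- κ) p) μ q
    H≈D : ∀ i j → H i j ≈ D i j
    H≈D i j = R.trans (H≈ i j)
        (solve 6 (λ k m a b x y → k :* a :* b :- m :* x :* y :=
        (con (+ 0) :- (:- k) :* a :* b) :- m :* x :* y) R.refl κ μ (p i) (p j) (q i) (q j))
    form-H : ∀ x → form H x x ≈ κ * (dot p x * dot p x) - μ * (dot q x * dot q x)
    form-H x = begin
      form H x x                 ≈⟨ dot-congʳ x (λ i → dot-congˡ x (H≈D i)) ⟩
      form D x x                 ≈⟨ form-deflate (deflate Z (- κ) p) μ q x x ⟩
      form (deflate Z (- κ) p) x x - μ * (dot q x * dot q x)       ≈⟨ R.+-congʳ (form-deflate Z (- κ) p x x) ⟩
      form Z x x - - κ * (dot p x * dot p x) - μ * (dot q x * dot q x)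
        ≈⟨ R.+-congʳ (R.+-congʳ (dot-zeroʳ x λ i → R.trans (dot-comm (Z i) x) (dot-zeroʳ x λ _ → R.refl))) ⟩
      0# - - κ * (dot p x * dot p x) - μ * (dot q x * dot q x)
        ≈⟨ solve 3 (λ k a b → con (+ 0) :- (:- k) :* a :- b := k :* a :- b) R.refl κ (dot p x * dot p x)
            (μ * (dot q x * dot q x)) ⟩
      κ * (dot p x * dot p x) - μ * (dot q x * dot q x) ∎

  -- The assumption 1 ≤ t makes the factor t^h - 1 of the subtracted square nonnegative. All
  -- coefficients are powers of t, so the support is the full simplex, and in degree two the only
  -- Hessian is the one at β = 0.
  weight-Lorentzian : ∀ {n} (g : Weight (suc n)) t → 1# ≤ t → Lorentzian (suc n) 2 (λ α → t ^ weigh g α)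
  weight-Lorentzian {n} g@(weight u h A) t 1≤t = record
    { degree≥2        = ℕ.≤-refl
    ; nonnegative     = λ {α} _ → inj₁ (c-pos α)
    ; nonzero         = nonzero
    ; support-mconvex = simplex-mconvex proj₁ (λ {α} α∈ → α∈ , pos⇒≉0 (c-pos α)) nonzero
    ; hessian-sign    = λ {β} β∈ → ≡.subst (λ β → AtMostOnePositiveEigenvalue (hessian c β))
        (≡.sym (all-zero β β∈))
                          (rank-two⇒one-positive (hessian c (replicate (suc n) 0)) p q
                              (≤⇒0≤- (1≤^ 1≤t h)) entry)
    }
    where
    open ≈-Reasoning
    c : Family (suc n)
    c α = t ^ weigh g α
    c-pos : ∀ α → 0# < c α
    c-pos α = ^-pos (1≤⇒0< 1≤t) (weigh g α)
    nonzero : ∃ (Support (suc n) 2 c)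
    nonzero = e₁ ⊕ e₁ , ≡.trans (sum-⊕ e₁ e₁)
        (≡.cong₂ ℕ._+_ (sum-e {suc n} zero) (sum-e {suc n} zero)) , pos⇒≉0 (c-pos (e₁ ⊕ e₁))
      where
      e₁ : Exponent (suc n)
      e₁ = e zero
    p q : Vector Carrier (suc n)
    p i = t ^ lookup u i
    q i = if lookup A i then p i else 0#
    κ = t ^ h
    cases : ∀ a b x y → x * y * t ^ (if a ∧ b then 0 else h) ≈
                        κ * x * y - (κ - 1#) * (if a then x else 0#) * (if b then y else 0#)
    cases true  true  x y = solve 4 (λ k x y o → x :* y :* o := k :* x :* y :- (k :- o) :* x :* y)
        R.refl κ x y 1#
    cases true  false x y = solve 4 (λ k x y o → x :* y :* k := k :* x :* y :- (k :- o) :* x :* con (+ 0))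
        R.refl κ x y 1#
    cases false true  x y = solve 4 (λ k x y o → x :* y :* k := k :* x :* y :- (k :- o) :* con (+ 0) :* y)
        R.refl κ x y 1#
    cases false false x y = solve 4
        (λ k x y o → x :* y :* k := k :* x :* y :- (k :- o) :* con (+ 0) :* con (+ 0)) R.refl κ x y 1#
    entry : ∀ i j → hessian c (replicate (suc n) 0) i j ≈ κ * p i * p j - (κ - 1#) * q i * q j
    entry i j = begin
      t ^ weigh g (replicate (suc n) 0 ⊕ e i ⊕ e j)
        ≡⟨ ≡.cong (t ^_) (≡.trans (≡.cong (λ β → weigh g (β ⊕ e j)) (0⊕ (e i))) (weigh-e⊕e u h A i j)) ⟩
      t ^ (lookup u i ℕ.+ lookup u j ℕ.+ (if lookup A i ∧ lookup A j then 0 else h))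
        ≈⟨ R.trans (^-homo-* t (lookup u i ℕ.+ lookup u j) _)
            (R.*-congʳ (^-homo-* t (lookup u i) (lookup u j))) ⟩
      p i * p j * t ^ (if lookup A i ∧ lookup A j then 0 else h)
        ≈⟨ cases (lookup A i) (lookup A j) (p i) (p j) ⟩
      κ * p i * p j - (κ - 1#) * q i * q j ∎

  link-full : ∀ {n d} β → Simplex n d β → ∀ {γ} → Simplex n 2 γ → γ ∈ link (Δ n (d ℕ.+ 2)) β
  link-full β β∈ {γ} γ∈ with degree-two γ γ∈
  ... | i , j , γ≡ = i , j , γ≡ , ≡.trans (sum-⊕-e-e β i j) (≡.cong (ℕ._+ 2) β∈)

  weight-L⁺ : ∀ {n d} (g : Weight (suc n)) β → Simplex (suc n) d β → ∀ t → 1# ≤ t →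
              L⁺ (link (Δ (suc n) (d ℕ.+ 2)) β) (λ α → t ^ weigh g α)
  weight-L⁺ g β β∈ t 1≤t = weight-Lorentzian g t 1≤t ,
    λ {α} α∈ → mk⇔ (λ _ → link-full β β∈ α∈) (λ _ → ^-pos (1≤⇒0< 1≤t) (weigh g α))

  -- Separation of w₄ from the cone

  module _ {A : Set} where

    ∑ₗ-cong : ∀ (L : List A) {f g} → (∀ {x} → x ∈ₗ L → f x ≈ g x) → ∑ₗ L f ≈ ∑ₗ L g
    ∑ₗ-cong []      p = R.refl
    ∑ₗ-cong (x ∷ L) p = R.+-cong (p (here ≡.refl)) (∑ₗ-cong L λ x∈ → p (there x∈))

    ∑ₗ-zero : ∀ (L : List A) {f} → (∀ {x} → x ∈ₗ L → f x ≈ 0#) → ∑ₗ L f ≈ 0#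
    ∑ₗ-zero []      p = R.refl
    ∑ₗ-zero (x ∷ L) p = R.trans (R.+-cong (p (here ≡.refl)) (∑ₗ-zero L λ x∈ → p (there x∈)))
        (R.+-identityʳ 0#)

    ∑ₗ-+ : ∀ (L : List A) f g → ∑ₗ L (λ x → f x + g x) ≈ ∑ₗ L f + ∑ₗ L g
    ∑ₗ-+ []      f g = R.sym (R.+-identityʳ 0#)
    ∑ₗ-+ (x ∷ L) f g = R.trans (R.+-congˡ (∑ₗ-+ L f g))
      (solve 4 (λ a b c d → (a :+ b) :+ (c :+ d) := (a :+ c) :+ (b :+ d)) R.refl _ _ _ _)

    ∑ₗ-* : ∀ a (L : List A) f → ∑ₗ L (λ x → a * f x) ≈ a * ∑ₗ L f
    ∑ₗ-* a []      f = R.sym (R.zeroʳ a)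
    ∑ₗ-* a (x ∷ L) f = R.trans (R.+-congˡ (∑ₗ-* a L f)) (R.sym (R.distribˡ a _ _))

    ∑ₗ-∑ : ∀ {k} (L : List A) (f : Fin k → A → Carrier) → ∑ₗ L (λ x → ∑ (λ i → f i x)) ≈ ∑ (λ i → ∑ₗ L (f i))
    ∑ₗ-∑ {zero}  L f = ∑ₗ-zero L λ _ → R.refl
    ∑ₗ-∑ {suc k} L f = R.trans (∑ₗ-+ L (f zero) (λ x → ∑ (λ i → f (suc i) x)))
        (R.+-congˡ (∑ₗ-∑ L λ i → f (suc i)))

  ∑ₗ-swap : ∀ {A B : Set} (L : List A) (K : List B) (f : A → B → Carrier) →
            ∑ₗ L (λ x → ∑ₗ K (f x)) ≈ ∑ₗ K (λ y → ∑ₗ L (λ x → f x y))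
  ∑ₗ-swap []      K f = R.sym (∑ₗ-zero K λ _ → R.refl)
  ∑ₗ-swap (x ∷ L) K f = R.trans (R.+-congˡ (∑ₗ-swap L K f)) (R.sym (∑ₗ-+ K (f x) λ y → ∑ₗ L λ x → f x y))

  ε-same : ∀ {n} (α : Exponent n) → ε α α ≈ 1#
  ε-same α with α ≟ α
  ... | yes _   = R.refl
  ... | no  α≢α = ⊥-elim (α≢α ≡.refl)

  ε-other : ∀ {n} {α β : Exponent n} → ¬ (α ≡ β) → ε α β ≈ 0#
  ε-other {α = α} {β} α≢β with α ≟ β
  ... | yes α≡β = ⊥-elim (α≢β α≡β)
  ... | no  _   = R.refl

  ∑ₗ-ε : ∀ {n} {L : List (Exponent n)} → Unique L → ∀ (g : Family n) {α} → α ∈ₗ L → ∑ₗ L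
      (λ β → g β * ε α β) ≈ g α
  ∑ₗ-ε {L = β ∷ L} (β∉L ∷ _) g (here ≡.refl) = R.trans
    (R.+-cong (R.trans (R.*-congˡ (ε-same β)) (R.*-identityʳ (g β)))
              (∑ₗ-zero L λ γ∈ → R.trans (R.*-congˡ (ε-other (All.lookup β∉L γ∈))) (R.zeroʳ _)))
    (R.+-identityʳ (g β))
  ∑ₗ-ε {L = β ∷ L} (β∉L ∷ unique) g (there α∈) = R.trans
    (R.+-cong (R.trans (R.*-congˡ (ε-other λ α≡β → All.lookup β∉L α∈ (≡.sym α≡β))) (R.zeroʳ _))
        (∑ₗ-ε unique g α∈))
    (R.+-identityˡ _)

  -- The separating functional: on every link of Δ₄⁴ it is a sum of the weights of split quadrics, although it is
  -- positive on w₄. It was found by linear programming and is invariant under exchanging x₁ with x₃ and x₂ with x₄.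
  ℓ : Exponent 4 → ℕ
  ℓ (α₁ ∷ α₂ ∷ α₃ ∷ α₄ ∷ []) = 4 ℕ.+ by-degree (α₁ ℕ.+ α₃) (α₁ ℕ.⊓ α₃) (α₂ ℕ.⊓ α₄)
    where
    by-degree : ℕ → ℕ → ℕ → ℕ
    by-degree 0 m k = 4 ℕ.* k
    by-degree 1 m k = 2 ℕ.+ 4 ℕ.* k
    by-degree 2 m k = 4 ℕ.+ 4 ℕ.* (m ℕ.* k)
    by-degree 3 m k = 2 ℕ.+ 4 ℕ.* m
    by-degree _ m k = 4 ℕ.* (m ℕ.⊓ 1)

  -- All ten exponents of degree two are listed; the last clause catches only other degrees. At 0200
  -- and 0002 ℓ is linear on the link and a square suffices. At 1010 the coefficients of x₂² and x₄²
  -- are lowered by separate quadrics, since a single one with A = {2, 4} would lower that of x₂x₄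
  -- too. The summand 4 of ℓ does not affect its pairing with `w₄`, whose entries sum to 0, and lets
  -- the entries of `u` here be natural.
  splits : Exponent 4 → List (Weight 4)
  splits (2 ∷ 0 ∷ 0 ∷ 0 ∷ []) = weight (0 ∷ 2 ∷ 4 ∷ 2 ∷ []) 4 (false ∷ false ∷ true ∷ false ∷ []) ∷ []
  splits (1 ∷ 1 ∷ 0 ∷ 0 ∷ []) = weight (3 ∷ 1 ∷ 3 ∷ 5 ∷ []) 4 (true ∷ false ∷ false ∷ true ∷ []) ∷ []
  splits (1 ∷ 0 ∷ 1 ∷ 0 ∷ []) = weight (0 ∷ 2 ∷ 0 ∷ 2 ∷ []) 4 (false ∷ true ∷ false ∷ false ∷ [])
                              ∷ weight (0 ∷ 0 ∷ 0 ∷ 0 ∷ []) 4 (false ∷ false ∷ false ∷ true ∷ []) ∷ []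
  splits (1 ∷ 0 ∷ 0 ∷ 1 ∷ []) = weight (3 ∷ 5 ∷ 3 ∷ 1 ∷ []) 4 (true ∷ true ∷ false ∷ false ∷ []) ∷ []
  splits (0 ∷ 2 ∷ 0 ∷ 0 ∷ []) = weight (4 ∷ 2 ∷ 4 ∷ 6 ∷ []) 0 (false ∷ false ∷ false ∷ false ∷ []) ∷ []
  splits (0 ∷ 1 ∷ 1 ∷ 0 ∷ []) = weight (5 ∷ 3 ∷ 1 ∷ 3 ∷ []) 4 (true ∷ true ∷ false ∷ false ∷ []) ∷ []
  splits (0 ∷ 1 ∷ 0 ∷ 1 ∷ []) = weight (4 ∷ 2 ∷ 0 ∷ 2 ∷ []) 4 (true ∷ true ∷ false ∷ false ∷ [])
                              ∷ weight (0 ∷ 0 ∷ 0 ∷ 0 ∷ []) 4 (true ∷ false ∷ false ∷ true ∷ []) ∷ []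
  splits (0 ∷ 0 ∷ 2 ∷ 0 ∷ []) = weight (4 ∷ 2 ∷ 0 ∷ 2 ∷ []) 4 (true ∷ false ∷ false ∷ false ∷ []) ∷ []
  splits (0 ∷ 0 ∷ 1 ∷ 1 ∷ []) = weight (5 ∷ 3 ∷ 1 ∷ 3 ∷ []) 4 (true ∷ false ∷ false ∷ true ∷ []) ∷ []
  splits (0 ∷ 0 ∷ 0 ∷ 2 ∷ []) = weight (4 ∷ 6 ∷ 4 ∷ 2 ∷ []) 0 (false ∷ false ∷ false ∷ false ∷ []) ∷ []
  splits _                    = []

  -- A finite check over 10 · 10 pairs, settled by evaluation.
  ℓ-splits : All (λ β → All (λ γ → ℓ (β ⊕ γ) ≡ ∑ₗℕ (splits β) (λ g → weigh g γ)) (simplex 4 2)) (simplex 4 2)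
  ℓ-splits = from-yes
      (All.all? (λ β → All.all? (λ γ → ℓ (β ⊕ γ) ℕ.≟ ∑ₗℕ (splits β) (λ g → weigh g γ)) (simplex 4 2))
      (simplex 4 2))

  ⟨ℓ,_⟩ : Family 4 → Carrier
  ⟨ℓ, w ⟩ = ∑ₗ (simplex 4 4) λ α → fromℕ (ℓ α) * w α

  ⟨ℓ,w₄⟩-pos : 0# < ⟨ℓ, w₄ ⟩
  -- Over ℤ the pairing evaluates to 8 + 8 + 12 - 8 - 8 - 8 = 4.
  ⟨ℓ,w₄⟩-pos = <-≤-trans (fromℕ-pos {4} (ℕ.s≤s ℕ.z≤n)) (inj₂ (R.sym (integral-sum (simplex 4 4))))
    where
    integral-sum : ∀ L → ∑ₗ L (λ α → fromℕ (ℓ α) * w₄ α) ≈ fromℤ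
        (foldr ℤ._+_ (+ 0) (List.map (λ α → + ℓ α ℤ.* w₄ᶻ α) L))
    integral-sum []      = R.refl
    integral-sum (α ∷ L) = R.trans
      (R.+-cong (R.trans (R.*-congˡ (w₄≈fromℤ α)) (R.sym (fromℤ-* (+ ℓ α) (w₄ᶻ α)))) (integral-sum L))
      (R.sym (fromℤ-+ (+ ℓ α ℤ.* w₄ᶻ α) _))

  -- Pairing with a lifted vector only sees the restriction of ℓ to the link of β. There ℓ splits
  -- into the exponents in `splits β`, and `BR-nonpositive` applies to each of them separately.
  ⟨ℓ,⟩-generator : ∀ {w} → LocalGenerators (Δ 4 4) w → ⟨ℓ, w ⟩ ≤ 0#
  ⟨ℓ,⟩-generator {w} (β , β∈ , _ , v , v∈BR , w≈) = ≤.trans (inj₂ pairing)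
      (≤.trans (inj₂ decomposed) (sums≤0 (splits β)))
    where
    open ≈-Reasoning
    S = link (Δ 4 4) β
    β∈ₗ = simplex-complete β β∈

    elements≡ : Subset.elements S ≡ simplex 4 2
    elements≡ = elements-full S (link-full β β∈)

    pairing : ⟨ℓ, w ⟩ ≈ ∑ₗ (simplex 4 2) (λ γ → v γ * fromℕ (ℓ (β ⊕ γ)))
    pairing = begin
      ∑ₗ (simplex 4 4) (λ α → fromℕ (ℓ α) * w α)
        ≈⟨ ∑ₗ-cong (simplex 4 4) (λ {α} α∈ → R.*-congˡ {fromℕ (ℓ α)} (w≈ {α} (simplex-sound α α∈))) ⟩
      ∑ₗ (simplex 4 4) (λ α → fromℕ (ℓ α) * ∑ₗ (Subset.elements S) (λ γ → v γ * ε (β ⊕ γ) α))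
        ≡⟨ ≡.cong (λ L → ∑ₗ (simplex 4 4) (λ α → fromℕ (ℓ α) * ∑ₗ L (λ γ → v γ * ε (β ⊕ γ) α))) elements≡ ⟩
      ∑ₗ (simplex 4 4) (λ α → fromℕ (ℓ α) * ∑ₗ (simplex 4 2) (λ γ → v γ * ε (β ⊕ γ) α))
        ≈⟨ ∑ₗ-cong (simplex 4 4)
            (λ {α} _ → R.sym (∑ₗ-* (fromℕ (ℓ α)) (simplex 4 2) (λ γ → v γ * ε (β ⊕ γ) α))) ⟩
      ∑ₗ (simplex 4 4) (λ α → ∑ₗ (simplex 4 2) (λ γ → fromℕ (ℓ α) * (v γ * ε (β ⊕ γ) α)))
        ≈⟨ ∑ₗ-swap (simplex 4 4) (simplex 4 2) (λ α γ → fromℕ (ℓ α) * (v γ * ε (β ⊕ γ) α)) ⟩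
      ∑ₗ (simplex 4 2) (λ γ → ∑ₗ (simplex 4 4) (λ α → fromℕ (ℓ α) * (v γ * ε (β ⊕ γ) α)))
        ≈⟨ ∑ₗ-cong (simplex 4 2) (λ {γ} γ∈ → evaluate γ (simplex-sound γ γ∈)) ⟩
      ∑ₗ (simplex 4 2) (λ γ → v γ * fromℕ (ℓ (β ⊕ γ))) ∎
      where
      evaluate : ∀ γ → Simplex 4 2 γ → ∑ₗ (simplex 4 4)
          (λ α → fromℕ (ℓ α) * (v γ * ε (β ⊕ γ) α)) ≈ v γ * fromℕ (ℓ (β ⊕ γ))
      evaluate γ γ∈ = begin
        ∑ₗ (simplex 4 4) (λ α → fromℕ (ℓ α) * (v γ * ε (β ⊕ γ) α))
          ≈⟨ ∑ₗ-cong (simplex 4 4)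
              (λ {α} _ → solve 3 (λ l v e → l :* (v :* e) := v :* (l :* e)) R.refl (fromℕ (ℓ α)) (v γ)
              (ε (β ⊕ γ) α)) ⟩
        ∑ₗ (simplex 4 4) (λ α → v γ * (fromℕ (ℓ α) * ε (β ⊕ γ) α))
          ≈⟨ ∑ₗ-* (v γ) (simplex 4 4) (λ α → fromℕ (ℓ α) * ε (β ⊕ γ) α) ⟩
        v γ * ∑ₗ (simplex 4 4) (λ α → fromℕ (ℓ α) * ε (β ⊕ γ) α)
          ≈⟨ R.*-congˡ
              (∑ₗ-ε (simplex-unique 4 4) (λ α → fromℕ (ℓ α))
              (simplex-complete (β ⊕ γ) (≡.trans (sum-⊕ β γ) (≡.cong₂ ℕ._+_ β∈ γ∈)))) ⟩
        v γ * fromℕ (ℓ (β ⊕ γ)) ∎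

    decomposed : ∑ₗ (simplex 4 2) (λ γ → v γ * fromℕ (ℓ (β ⊕ γ))) ≈ ∑ₗ (simplex 4 2)
        (λ γ → v γ * fromℕ (∑ₗℕ (splits β) (λ g → weigh g γ)))
    decomposed = ∑ₗ-cong (simplex 4 2) λ {γ} γ∈ → R.reflexive
        (≡.cong (λ k → v γ * fromℕ k) (All.lookup (All.lookup ℓ-splits β∈ₗ) γ∈))

    split≤0 : ∀ g → ∑ₗ (simplex 4 2) (λ γ → v γ * fromℕ (weigh g γ)) ≤ 0#
    split≤0 g = ≡.subst (λ L → ∑ₗ L (λ γ → v γ * fromℕ (weigh g γ)) ≤ 0#) elements≡
      (BR-nonpositive {S = S} (weigh g) (weight-L⁺ g β β∈) v∈BR)

    sums≤0 : ∀ G → ∑ₗ (simplex 4 2) (λ γ → v γ * fromℕ (∑ₗℕ G (λ g → weigh g γ))) ≤ 0#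
    sums≤0 []      = inj₂ (∑ₗ-zero (simplex 4 2) λ {γ} _ → R.zeroʳ (v γ))
    sums≤0 (g ∷ G) = ≤.trans (inj₂ (R.trans
        (∑ₗ-cong (simplex 4 2) λ {γ} _ → R.trans
            (R.*-congˡ (×-homo-+ 1# (weigh g γ) (∑ₗℕ G (λ g → weigh g γ)))) (R.distribˡ (v γ) _ _))
        (∑ₗ-+ (simplex 4 2) (λ γ → v γ * fromℕ (weigh g γ)) (λ γ → v γ * fromℕ (∑ₗℕ G (λ g → weigh g γ))))))
      (≤.trans (+-mono-≤ (split≤0 g) (sums≤0 G)) (inj₂ (R.+-identityʳ 0#)))

  w₄∉Cone : ¬ Cone (Δ 4 4) (LocalGenerators (Δ 4 4)) w₄
  w₄∉Cone (k , t , u , t≥0 , u∈ , w₄≈) = ≤⇒≯ (≤.trans (inj₂ expand) (∑-nonpositive λ i →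
      ≤.trans (*-monoʳ-≤ (t≥0 i) (⟨ℓ,⟩-generator (u∈ i))) (inj₂ (R.zeroʳ (t i))))) ⟨ℓ,w₄⟩-pos
    where
    open ≈-Reasoning
    ∑-nonpositive : ∀ {k} {f : Fin k → Carrier} → (∀ i → f i ≤ 0#) → ∑ f ≤ 0#
    ∑-nonpositive {zero}  p = ≤.refl
    ∑-nonpositive {suc k} p = ≤.trans (+-mono-≤ (p zero) (∑-nonpositive λ i → p (suc i)))
        (inj₂ (R.+-identityʳ 0#))

    expand : ⟨ℓ, w₄ ⟩ ≈ ∑ (λ i → t i * ⟨ℓ, u i ⟩)
    expand = begin
      ∑ₗ (simplex 4 4) (λ α → fromℕ (ℓ α) * w₄ α)
        ≈⟨ ∑ₗ-cong (simplex 4 4)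
            (λ {α} α∈ → R.trans (R.*-congˡ (w₄≈ {α} (simplex-sound α α∈)))
            (*-distribˡ-sum (fromℕ (ℓ α)) (λ i → t i * u i α))) ⟩
      ∑ₗ (simplex 4 4) (λ α → ∑ (λ i → fromℕ (ℓ α) * (t i * u i α)))
        ≈⟨ ∑ₗ-∑ (simplex 4 4) (λ i α → fromℕ (ℓ α) * (t i * u i α)) ⟩
      ∑ (λ i → ∑ₗ (simplex 4 4) (λ α → fromℕ (ℓ α) * (t i * u i α)))
        ≈⟨ sum-cong-≋ (λ i → R.trans
             (∑ₗ-cong (simplex 4 4)
                 (λ {α} _ → solve 3 (λ l t u → l :* (t :* u) := t :* (l :* u)) R.refl (fromℕ (ℓ α)) (t i)
                 (u i α)))
             (∑ₗ-* (t i) (simplex 4 4) (λ α → fromℕ (ℓ α) * u i α))) ⟩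
      ∑ (λ i → t i * ⟨ℓ, u i ⟩) ∎

theorem4p2 : (ℝ : CompleteOrderedField) → let open Reals ℝ in
    (∀ c → L⁺ (Δ 4 4) c → R₄ c ≤ fromℕ 64) ×
    (BR (Δ 4 4) w₄ × ¬ Cone (Δ 4 4) (LocalGenerators (Δ 4 4)) w₄)
theorem4p2 ℝ = (λ c → R₄≤64 ℝ) , (fromℕ 64 , ratio≤64 ℝ) , w₄∉Cone ℝ
  where open Reals ℝ
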